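{- The set $\{[A]\in\mathrm{MALG}: \Phi(A) \text{ is a complete } \boldsymbol{\Pi}^0_3 \text{ set}\}$ is comeager in $\mathrm{MALG}$.
   Context: $2^\omega$ is the Cantor space; $N_s=\{x: s\subset x\}$; $\mu$ the coin-tossing measure with $\mu(N_s)=2^{ -\mathrm{lh}(s)}$. For measurable $A$, $\Phi(A)=\{x: \lim_n\mu(A\cap N_{x\restriction n})/\mu(N_{x\restriction n})=1\}$; $\Phi(A)$ depends only on the class $[A]$. $\mathrm{MALG}$ is the set of classes $[A]$ of measurable sets modulo null sets, with the Polish metric $\delta([A],[B])=\mu(A\triangle B)$. A set is complete $\boldsymbol{\Pi}^0_3$ if it is $F_{\sigma\delta}$ and every $F_{\sigma\delta}$ subset of $2^\omega$ is a continuous preimage of it (equivalently it is $F_{\sigma\delta}$ but not $G_{\delta\sigma}$). -}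

module Defs where

import Algebra.Definitions.RawSemiring as RawSemiringDefs
open import Axiom.ExcludedMiddle using (ExcludedMiddle)
open import Data.Bool.Base using (Bool; false)
open import Data.Empty using (⊥-elim)
open import Data.Fin.Base using (toℕ)
open import Data.Integer.Base using (+_; +≤+)
import Data.Integer.Base as ℤ
import Data.Integer.Properties as ℤ
open import Data.List.Base using (List; length; applyUpTo; replicate)
open import Data.List.Properties using (length-replicate)
open import Data.Nat.Base as ℕ using (ℕ; zero; suc)
open import Data.Nat.Coprimality using (1-coprimeTo)
import Data.Nat.Properties as ℕ
open import Data.Product.Base using (Σ-syntax; ∃-syntax; _×_; _,_; proj₁; proj₂)
open import Data.Rational.Base
  using (ℚ; mkℚ; 0ℚ; 1ℚ; ½; _+_; _-_; -_; _*_; _≤_; _<_; *≤*; *<*; 1/_; Positive; +-*-rawSemiring)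
import Data.Rational.Properties as ℚ
import Data.Rational.Unnormalised.Base as ℚᵘ
import Data.Rational.Unnormalised.Properties as ℚᵘ
open import Data.Rational.Solver using (module +-*-Solver)
open import Data.Sum.Base using (inj₁; inj₂; swap)
open import Function.Base using (_∘_)
open import Function.Metric.Structures using (IsGeneralMetric)
open import Level using (Level; 0ℓ; _⊔_) renaming (suc to lsuc)
open import Relation.Binary.Core using (Rel)
open import Relation.Binary.PropositionalEquality using (_≡_; refl; sym; trans; cong; subst)
open import Relation.Nullary.Decidable.Core using (yes; no)
open import Relation.Nullary.Negation.Core using (¬_)
open import Relation.Unary using (Pred; _∈_; _⊆_; _≐_; _∩_; _∪_; _∖_; ∁; ⋃; ⋂; _⊢_)

open RawSemiringDefs +-*-rawSemiring using (sum; _^_)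

-- An extended real number r is represented by its (rounded) upper Dedekind
-- cut: r ≺ q says that r is less than the rational q.  Under excluded middle
-- these cuts are exactly the elements of [-∞, ∞].

infix 4 _≺_ _≼_ _≋_
infixl 6 _⊕_
infixl 7 _÷_

record Real : Set₁ where
  field
    cut     : Pred ℚ 0ℓ
    upper   : ∀ {p q} → p ≤ q → cut p → cut q
    rounded : ∀ {q} → cut q → ∃[ p ] p < q × cut p

open Real

_≺_ : Real → ℚ → Set
r ≺ q = cut r q

_≼_ : Rel Real 0ℓ
r ≼ s = cut s ⊆ cut r

_≋_ : Rel Real 0ℓ
r ≋ s = cut r ≐ cut s

fromℚ : ℚ → Real
fromℚ p = record
  { cut     = p <_
  ; upper   = λ q≤q′ p<q → ℚ.<-≤-trans p<q q≤q′
  ; rounded = λ p<q → let (m , p<m , m<q) = ℚ.<-dense p<q in m , m<q , p<m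
  }

_⊕_ : Real → Real → Real
r ⊕ s = record
  { cut     = λ q → ∃[ a ] ∃[ b ] r ≺ a × s ≺ b × a + b ≤ q
  ; upper   = λ p≤q (a , b , r≺a , s≺b , le) → a , b , r≺a , s≺b , ℚ.≤-trans le p≤q
  ; rounded = λ (a , b , r≺a , s≺b , le) →
      let (a′ , a′<a , r≺a′) = rounded r r≺a
      in  a′ + b , ℚ.<-≤-trans (ℚ.+-monoˡ-< b a′<a) le , a′ , b , r≺a′ , s≺b , ℚ.≤-refl
  }

_÷_ : Real → (c : ℚ) → .{{Positive c}} → Real
r ÷ c = record
  { cut     = λ q → r ≺ q * c
  ; upper   = λ p≤q → upper r (ℚ.*-monoʳ-≤-nonNeg c p≤q)
  ; rounded = λ {q} r≺qc →
      let (p , p<qc , r≺p) = rounded r r≺qc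
          eq : p * 1/ c * c ≡ p
          eq = trans (ℚ.*-assoc p (1/ c) c)
                 (trans (cong (p *_) (ℚ.*-inverseˡ c)) (ℚ.*-identityʳ p))
      in  p * 1/ c
        , ℚ.*-cancelʳ-<-nonNeg c (subst (_< q * c) (sym eq) p<qc)
        , subst (r ≺_) (sym eq) r≺p
  }
  where
  instance
    _ = ℚ.pos⇒nonZero c
    _ = ℚ.pos⇒nonNeg c

_⟶_ : (ℕ → Real) → ℚ → Set
r ⟶ l = ∀ ε → 0ℚ < ε → ∃[ k ] ∀ n → k ℕ.≤ n → r n ≺ l + ε × ¬ (r n ≺ l - ε)

record MetricSpace (a ℓ : Level) : Set (lsuc (a ⊔ ℓ)) where
  field
    Carrier         : Set a
    _≈_             : Rel Carrier ℓ
    d               : Carrier → Carrier → Real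
    isGeneralMetric : IsGeneralMetric _≈_ _≋_ _≼_ (fromℚ 0ℚ) _⊕_ d

module _ {a ℓ} (M : MetricSpace a ℓ) where
  open MetricSpace M

  -- Open sets are closed under _≈_, since d x y ≺ ε for all ε > 0 if x ≈ y.
  OpenIn : ∀ {u} → Pred Carrier u → Set (a ⊔ u)
  OpenIn U = ∀ x → x ∈ U → ∃[ ε ] 0ℚ < ε × (∀ y → d x y ≺ ε → y ∈ U)

  DenseIn : ∀ {u} → Pred Carrier u → Set (a ⊔ u)
  DenseIn U = ∀ x ε → 0ℚ < ε → ∃[ y ] d x y ≺ ε × y ∈ U

  -- No generality is lost by letting the sets U n have level 0ℓ: under
  -- excluded middle every predicate is equivalent to a Bool-valued one.
  Comeager : ∀ {p} → Pred Carrier p → Set (lsuc 0ℓ ⊔ a ⊔ p)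
  Comeager P = Σ[ U ∈ (ℕ → Pred Carrier 0ℓ) ]
    (∀ n → OpenIn (U n)) × (∀ n → DenseIn (U n)) × ⋂ ℕ U ⊆ P

Cantor : Set
Cantor = ℕ → Bool

_↾_ : Cantor → ℕ → List Bool
_↾_ = applyUpTo

N : List Bool → Pred Cantor 0ℓ
N s x = x ↾ length s ≡ s

½^-pos : ∀ n → Positive (½ ^ n)
½^-pos zero    = _
½^-pos (suc n) = ℚ.pos*pos⇒pos ½ (½ ^ n) {{ ½^-pos n }}

partialSum : (ℕ → List Bool) → ℕ → ℚ
partialSum c n = sum {n} (λ i → ½ ^ length (c (toℕ i)))

-- The outer measure: the infimum of ∑ᵢ 2^(-lh (c i)) over the countable covers
-- of A by basic open sets N (c i).  Restricted to the measurable sets it is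
-- the (completed) coin-tossing measure.
μ : Pred Cantor 0ℓ → Real
μ A = record
  { cut     = λ q → ∃[ c ] A ⊆ ⋃ ℕ (N ∘ c) × ∃[ r ] r < q × (∀ n → partialSum c n ≤ r)
  ; upper   = λ p≤q (c , cov , r , r<p , le) → c , cov , r , ℚ.<-≤-trans r<p p≤q , le
  ; rounded = λ (c , cov , r , r<q , le) →
      let (m , r<m , m<q) = ℚ.<-dense r<q in m , m<q , c , cov , r , r<m , le
  }

-- Carathéodory's criterion
Measurable : Pred Cantor 0ℓ → Set₁
Measurable A = ∀ (E : Pred Cantor 0ℓ) → μ E ≋ μ (E ∩ A) ⊕ μ (E ∖ A)

record MeasurableSet : Set₁ where
  field
    set        : Pred Cantor 0ℓ
    measurable : Measurable set

open MeasurableSet public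

_△_ : Pred Cantor 0ℓ → Pred Cantor 0ℓ → Pred Cantor 0ℓ
A △ B = (A ∖ B) ∪ (B ∖ A)

δ : MeasurableSet → MeasurableSet → Real
δ A B = μ (set A △ set B)

-- The division is by μ (N s) = 2^(-lh s).
density : Pred Cantor 0ℓ → List Bool → Real
density A s = (μ (A ∩ N s) ÷ ½ ^ length s) {{ ½^-pos (length s) }}

Φ : Pred Cantor 0ℓ → Pred Cantor 0ℓ
Φ A x = (λ n → density A (x ↾ n)) ⟶ 1ℚ

Open : Pred Cantor 0ℓ → Set
Open U = ∀ x → x ∈ U → ∃[ n ] N (x ↾ n) ⊆ U

Closed : Pred Cantor 0ℓ → Set
Closed C = Open (∁ C)

Fσδ : Pred Cantor 0ℓ → Set₁
Fσδ P = Σ[ C ∈ (ℕ → ℕ → Pred Cantor 0ℓ) ]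
  (∀ m n → Closed (C m n)) × P ≐ ⋂ ℕ (λ m → ⋃ ℕ (C m))

Continuous : (Cantor → Cantor) → Set₁
Continuous f = ∀ U → Open U → Open (f ⊢ U)

CompleteΠ⁰₃ : Pred Cantor 0ℓ → Set₁
CompleteΠ⁰₃ P = Fσδ P × (∀ Q → Fσδ Q → ∃[ f ] Continuous f × Q ≐ (f ⊢ P))

μ-mono : ∀ {A B} → A ⊆ B → μ A ≼ μ B
μ-mono A⊆B (c , cov , rest) = c , cov ∘ A⊆B , rest

interleave : (ℕ → List Bool) → (ℕ → List Bool) → ℕ → List Bool
interleave c e zero    = c zero
interleave c e (suc n) = interleave e (c ∘ suc) n

interleave-∋ˡ : ∀ c e i → ∃[ j ] interleave c e j ≡ c i
interleave-∋ʳ : ∀ c e i → ∃[ j ] interleave c e j ≡ e i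
interleave-∋ˡ c e zero    = zero , refl
interleave-∋ˡ c e (suc i) = let (j , eq) = interleave-∋ʳ e (c ∘ suc) i in suc j , eq
interleave-∋ʳ c e i       = let (j , eq) = interleave-∋ˡ e (c ∘ suc) i in suc j , eq

0≤½^ : ∀ n → 0ℚ ≤ ½ ^ n
0≤½^ n = ℚ.<⇒≤ (ℚ.positive⁻¹ (½ ^ n) {{ ½^-pos n }})

partialSum-suc : ∀ c n → partialSum c n ≤ partialSum c (suc n)
partialSum-suc c zero    = ℚ.≤-trans (0≤½^ (length (c 0))) (ℚ.≤-reflexive (sym (ℚ.+-identityʳ _)))
partialSum-suc c (suc n) = ℚ.+-monoʳ-≤ (½ ^ length (c 0)) (partialSum-suc (c ∘ suc) n)

partialSum-interleave : ∀ c e n → partialSum (interleave c e) n ≤ partialSum c n + partialSum e n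
partialSum-interleave c e zero    = ℚ.≤-refl
partialSum-interleave c e (suc n) = begin
  w + partialSum (interleave e (c ∘ suc)) n         ≤⟨ ℚ.+-monoʳ-≤ w (partialSum-interleave e (c ∘ suc) n) ⟩
  w + (partialSum e n + partialSum (c ∘ suc) n)     ≡⟨ solve 3 (λ x y z → x :+ (y :+ z) := (x :+ z) :+ y) refl w (partialSum e n) _ ⟩
  (w + partialSum (c ∘ suc) n) + partialSum e n     ≤⟨ ℚ.+-monoʳ-≤ (w + partialSum (c ∘ suc) n) (partialSum-suc e n) ⟩
  partialSum c (suc n) + partialSum e (suc n)       ∎
  where
  open ℚ.≤-Reasoning
  open +-*-Solver
  w = ½ ^ length (c 0)

μ-∪ : ∀ {A B} → μ (A ∪ B) ≼ μ A ⊕ μ B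
μ-∪ (a , b , (c , covA , r , r<a , ler) , (e , covB , s , s<b , les) , a+b≤q)
  = interleave c e
  , (λ { (inj₁ x∈A) → let (i , h) = covA x∈A ; (j , eq) = interleave-∋ˡ c e i
                      in j , subst (λ s → N s _) (sym eq) h
       ; (inj₂ x∈B) → let (i , h) = covB x∈B ; (j , eq) = interleave-∋ʳ c e i
                      in j , subst (λ s → N s _) (sym eq) h })
  , r + s
  , ℚ.<-≤-trans (ℚ.+-mono-< r<a s<b) a+b≤q
  , λ n → ℚ.≤-trans (partialSum-interleave c e n) (ℚ.+-mono-≤ (ler n) (les n))

0≼μ : ∀ {A} → fromℚ 0ℚ ≼ μ A
0≼μ (_ , _ , r , r<q , le) = ℚ.≤-<-trans (le 0) r<q

half : ∀ k → (½ ^ suc k) + (½ ^ suc k) ≡ ½ ^ k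
half k = trans (sym (ℚ.*-distribʳ-+ (½ ^ k) ½ ½)) (ℚ.*-identityˡ (½ ^ k))

½^-< : ∀ k → ½ ^ suc k < ½ ^ k
½^-< k = begin-strict
  ½ ^ suc k                 ≡⟨ sym (ℚ.+-identityʳ _) ⟩
  (½ ^ suc k) + 0ℚ          <⟨ ℚ.+-monoʳ-< (½ ^ suc k) (ℚ.positive⁻¹ (½ ^ suc k) {{ ½^-pos (suc k) }}) ⟩
  (½ ^ suc k) + (½ ^ suc k) ≡⟨ half k ⟩
  ½ ^ k                     ∎
  where open ℚ.≤-Reasoning

1/suc : ℕ → ℚ
1/suc k = mkℚ (+ 1) k (1-coprimeTo (suc k))

½^≤1/suc : ∀ k → ½ ^ k ≤ 1/suc k
½^≤1/suc zero    = ℚ.≤-refl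
½^≤1/suc (suc k) = ℚ.≤-trans (ℚ.*-monoˡ-≤-nonNeg ½ (½^≤1/suc k)) (ℚ.toℚᵘ-cancel-≤
  (ℚᵘ.≤-respˡ-≃ (ℚᵘ.≃-sym (ℚ.toℚᵘ-homo-* ½ (1/suc k))) (ℚᵘ.*≤* (+≤+ le))))
  where
  le : 1 ℕ.* suc (suc k) ℕ.≤ 1 ℕ.* (2 ℕ.* suc k)
  le = ℕ.*-monoʳ-≤ 1 (ℕ.s≤s (ℕ.≤-trans (ℕ.≤-reflexive (cong suc (sym (ℕ.+-identityʳ k)))) (ℕ.m≤n+m (suc (k ℕ.+ 0)) k)))

½^-small : ∀ ε → 0ℚ < ε → ∃[ k ] ½ ^ k < ε
½^-small ε@(mkℚ (+ suc n) m _) _ = suc m , ℚ.<-≤-trans (½^-< m) (ℚ.≤-trans (½^≤1/suc m)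
  (*≤* (ℤ.*-monoʳ-≤-nonNeg (+ suc m) {+ 1} {+ suc n} (+≤+ (ℕ.s≤s ℕ.z≤n)))))
½^-small (mkℚ (+ 0) m _) (*<* (ℤ.+<+ ()))
½^-small (mkℚ (ℤ.-[1+ n ]) m _) (*<* ())

tiny : ℕ → ℕ → List Bool
tiny k zero    = replicate (suc k) false
tiny k (suc i) = tiny (suc k) i

partialSum-tiny : ∀ k n → partialSum (tiny k) n ≤ ½ ^ k
partialSum-tiny k zero    = 0≤½^ k
partialSum-tiny k (suc n) = begin
  (½ ^ length (tiny k 0)) + partialSum (tiny (suc k)) n ≡⟨ cong (λ l → (½ ^ l) + partialSum (tiny (suc k)) n) (length-replicate (suc k)) ⟩
  (½ ^ suc k) + partialSum (tiny (suc k)) n             ≤⟨ ℚ.+-monoʳ-≤ (½ ^ suc k) (partialSum-tiny (suc k) n) ⟩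
  (½ ^ suc k) + (½ ^ suc k)                             ≡⟨ half k ⟩
  ½ ^ k                                                 ∎
  where open ℚ.≤-Reasoning

empty⇒null : ∀ {A} → (∀ x → ¬ A x) → μ A ≋ fromℚ 0ℚ
empty⇒null {A} A=∅ = 0≼μ {A} , λ 0<q →
  let (k , lt) = ½^-small _ 0<q
  in  tiny k , (λ {x} x∈A → ⊥-elim (A=∅ x x∈A)) , ½ ^ k , lt , partialSum-tiny k

0⊕0 : fromℚ 0ℚ ⊕ fromℚ 0ℚ ≼ fromℚ 0ℚ
0⊕0 {q} 0<q = ½ * q , ½ * q , 0<½q , 0<½q
  , ℚ.≤-reflexive (trans (sym (ℚ.*-distribʳ-+ q ½ ½)) (ℚ.*-identityˡ q))
  where
  0<½q : 0ℚ < ½ * q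
  0<½q = subst (_< ½ * q) (ℚ.*-zeroʳ ½) (ℚ.*-monoʳ-<-pos ½ 0<q)

⊕-mono : ∀ {r r′ s s′} → r ≼ r′ → s ≼ s′ → r ⊕ s ≼ r′ ⊕ s′
⊕-mono r≼ s≼ (a , b , r≺a , s≺b , le) = a , b , r≼ r≺a , s≼ s≺b , le

0⊕ : ∀ r → fromℚ 0ℚ ⊕ r ≼ r
0⊕ r {q} r≺q = let (p , p<q , r≺p) = rounded r r≺q in
  q - p , p , subst (_< q - p) (ℚ.+-inverseʳ p) (ℚ.+-monoˡ-< (- p) p<q) , r≺p
  , ℚ.≤-reflexive (solve 2 (λ x y → (x :- y) :+ y := x) refl q p)
  where open +-*-Solver

-- MALG is the metric space of measurable sets, with almost equality as its
-- setoid equality in place of a quotient type.  The triangle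
-- inequality for δ needs excluded middle.
module _ (em : ExcludedMiddle 0ℓ) where

  δ-triangle : ∀ A B C → δ A C ≼ δ A B ⊕ δ B C
  δ-triangle A B C = μ-mono incl ∘ μ-∪ {set A △ set B} {set B △ set C}
    where
    incl : set A △ set C ⊆ (set A △ set B) ∪ (set B △ set C)
    incl {x} h with em {set B x} | h
    ... | yes b | inj₁ (a , ¬c) = inj₂ (inj₁ (b , ¬c))
    ... | yes b | inj₂ (c , ¬a) = inj₁ (inj₂ (b , ¬a))
    ... | no ¬b | inj₁ (a , ¬c) = inj₁ (inj₁ (a , ¬b))
    ... | no ¬b | inj₂ (c , ¬a) = inj₂ (inj₂ (c , ¬b))

  δ-sym : ∀ A B → δ A B ≼ δ B A
  δ-sym A B = μ-mono swap

  δ-trans₀ : ∀ A B C → δ A B ≋ fromℚ 0ℚ → δ B C ≋ fromℚ 0ℚ → δ A C ≋ fromℚ 0ℚ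
  δ-trans₀ A B C p q = 0≼μ {set A △ set C} ,
    (λ 0<q → δ-triangle A B C (⊕-mono {δ A B} {fromℚ 0ℚ} {δ B C} {fromℚ 0ℚ} (proj₂ p) (proj₂ q) (0⊕0 0<q)))

  δ-congˡ : ∀ A A′ B → δ A A′ ≋ fromℚ 0ℚ → δ A B ≼ δ A′ B
  δ-congˡ A A′ B p h = δ-triangle A A′ B
    (⊕-mono {δ A A′} {fromℚ 0ℚ} {δ A′ B} {δ A′ B} (proj₂ p) (λ z → z) (0⊕ (δ A′ B) h))

  δ-cong : ∀ A A′ B B′ → δ A A′ ≋ fromℚ 0ℚ → δ B B′ ≋ fromℚ 0ℚ → δ A B ≼ δ A′ B′
  δ-cong A A′ B B′ p q = δ-congˡ A A′ B p ∘ δ-sym A′ B ∘ δ-congˡ B B′ A′ q ∘ δ-sym B′ A′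

  δ-sym₀ : ∀ A B → δ A B ≋ fromℚ 0ℚ → δ B A ≋ fromℚ 0ℚ
  δ-sym₀ A B (p , q) = p ∘ δ-sym A B , δ-sym B A ∘ q

  -- Φ A depends only on the class of A, so a property of Φ A defines a subset
  -- of the quotient.
  Φ-cong : ∀ A B → δ A B ≋ fromℚ 0ℚ → Φ (set A) ≐ Φ (set B)
  Φ-cong A B p = go A B p , go B A (δ-sym₀ A B p)
    where
    le : ∀ A B → δ A B ≋ fromℚ 0ℚ → ∀ s → μ (set A ∩ N s) ≼ μ (set B ∩ N s)
    le A B p s {q} h = μ-mono incl (μ-∪ {set A △ set B} {set B ∩ N s}
      (⊕-mono {δ A B} {fromℚ 0ℚ} {μ (set B ∩ N s)} {μ (set B ∩ N s)} (proj₂ p) (λ z → z)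
        (0⊕ (μ (set B ∩ N s)) h)))
      where
      incl : set A ∩ N s ⊆ (set A △ set B) ∪ (set B ∩ N s)
      incl {x} (a , n) with em {set B x}
      ... | yes b = inj₂ (b , n)
      ... | no ¬b = inj₁ (inj₁ (a , ¬b))

    go : ∀ A B → δ A B ≋ fromℚ 0ℚ → Φ (set A) ⊆ Φ (set B)
    go A B p {x} x∈ΦA ε 0<ε = let (k , lim) = x∈ΦA ε 0<ε in k , λ n k≤n →
        le B A (δ-sym₀ A B p) (x ↾ n) (proj₁ (lim n k≤n))
      , λ lt → proj₂ (lim n k≤n) (le A B p (x ↾ n) lt)

  MALG : MetricSpace (lsuc 0ℓ) 0ℓ
  MALG = record
    { Carrier         = MeasurableSet
    ; _≈_             = λ A B → δ A B ≋ fromℚ 0ℚ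
    ; d               = δ
    ; isGeneralMetric = record
      { isSemiMetric = record
        { isQuasiSemiMetric = record
          { isPreMetric = record
            { isProtoMetric = record
              { isPartialOrder = record
                { isPreorder = record
                  { isEquivalence = record
                    { refl  = (λ z → z) , (λ z → z)
                    ; sym   = λ (p , q) → q , p
                    ; trans = λ (p , q) (p′ , q′) → p′ ∘ p , q ∘ q′
                    }
                  ; reflexive = proj₂
                  ; trans     = λ p q → p ∘ q
                  }
                ; antisym = λ p q → q , p
                }
              ; ≈-isEquivalence = record
                { refl  = λ {A} → empty⇒null
                    (λ { x (inj₁ (a , ¬a)) → ¬a a ; x (inj₂ (a , ¬a)) → ¬a a })
                ; sym   = λ {A} {B} → δ-sym₀ A B
                ; trans = λ {A} {B} {C} → δ-trans₀ A B C
                }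
              ; cong = λ {A} {A′} {B} {B′} p q →
                    δ-cong A′ A B′ B (δ-sym₀ A A′ p) (δ-sym₀ B B′ q)
                  , δ-cong A A′ B B′ p q
              ; nonNegative = λ {A} {B} → 0≼μ {set A △ set B}
              }
            ; ≈⇒0 = λ p → p
            }
          ; 0⇒≈ = λ p → p
          }
        ; sym = λ A B → δ-sym B A , δ-sym A B
        }
      ; triangle = δ-triangle
      }
    }

{-# OPTIONS --safe #-}
module Submission where

-- A generic A is, for infinitely many l, extremely close to a pattern of level
-- l: a clopen set that in every N s with lh s = l is either empty or all of N s
-- except for the hole N (s 0^l).  Inside a full N s the density of A can thus be
-- steered: along the zeros it decreases to about 1 - 2^-(r+1) at s 0^(l-r-1),
-- and after the next bit 1 it is close to 1 again.  From there a path that always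
-- moves to a half of at least the same density stays close to 1 until the next
-- pattern level, where it can only arrive in a full N s′.  A dip of rank r j at
-- the j-th level produces a point of Φ A if and only if r j → ∞.  For
-- Q = ⋂ₘ ⋃ₖ C m k with C m k closed, ranks are read off continuously from x
-- with r j → ∞ if and only if x ∈ Q.

open import Defs
import Algebra.Definitions.RawSemiring as RawSemiringDefs
open import Axiom.ExcludedMiddle using (ExcludedMiddle)
open import Data.Bool.Base using (Bool; true; false; not; if_then_else_)
import Data.Bool.Properties as Bool
open import Data.Empty using (⊥; ⊥-elim)
open import Data.List.Base using (List; []; _∷_; _∷ʳ_; length)
open import Data.List.Properties using (length-applyUpTo; applyUpTo-∷ʳ; length-++; ∷-injective)
open import Data.Nat.Base as ℕ using (ℕ; zero; suc; z≤n; s≤s)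
import Data.Nat.Properties as ℕ
open import Data.Product.Base using (∃-syntax; _×_; _,_; proj₁; proj₂)
open import Data.Rational.Base
  using (ℚ; 0ℚ; 1ℚ; ½; _+_; _-_; -_; _*_; _≤_; _<_; *≤*; 1/_; positive; +-*-rawSemiring)
import Data.Rational.Properties as ℚ
open import Data.Rational.Solver using (module +-*-Solver)
open import Data.Sum.Base using (_⊎_; inj₁; inj₂)
open import Function.Base using (_∘_; case_of_)
open import Level using (0ℓ)
open import Relation.Binary.Definitions using (tri<; tri≈; tri>)
open import Relation.Binary.PropositionalEquality using (_≡_; refl; sym; trans; cong; cong₂; subst)
open import Relation.Nullary.Decidable using (yes; no; does; dec-true; dec-false; decidable-stable)
open import Relation.Nullary.Negation.Core using (¬_; contradiction)
open import Relation.Unary using (Pred; _∈_; _⊆_; _≐_; _∩_; _∪_; _∖_; ⋃; ⋂; _⊢_)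

open RawSemiringDefs +-*-rawSemiring using (_^_)
open Real

-- Rational inequalities and powers of `½`.

gap-≤ : ∀ {p q} d → 0ℚ ≤ d → p + d ≡ q → p ≤ q
gap-≤ {p} d 0≤d eq = subst (p ≤_) eq
  (ℚ.≤-trans (ℚ.≤-reflexive (sym (ℚ.+-identityʳ p))) (ℚ.+-monoʳ-≤ p 0≤d))

gap-< : ∀ {p q} d → 0ℚ < d → p + d ≡ q → p < q
gap-< {p} d 0<d eq = subst (p <_) eq
  (ℚ.≤-<-trans (ℚ.≤-reflexive (sym (ℚ.+-identityʳ p))) (ℚ.+-monoʳ-< p 0<d))

<⇒≱ : ∀ {p q} → p < q → ¬ (q ≤ p)
<⇒≱ p<q q≤p = ℚ.<-irrefl refl (ℚ.<-≤-trans p<q q≤p)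

p<q⇒0<q-p : ∀ {p q} → p < q → 0ℚ < q - p
p<q⇒0<q-p {p} {q} p<q = subst (_< q - p) (ℚ.+-inverseʳ p) (ℚ.+-monoˡ-< (- p) p<q)

0<½* : ∀ {q} → 0ℚ < q → 0ℚ < ½ * q
0<½* {q} 0<q = subst (_< ½ * q) (ℚ.*-zeroʳ ½) (ℚ.*-monoʳ-<-pos ½ 0<q)

½*+½* : ∀ q → ½ * q + ½ * q ≡ q
½*+½* q = trans (sym (ℚ.*-distribʳ-+ q ½ ½)) (ℚ.*-identityˡ q)

0<½^ : ∀ n → 0ℚ < ½ ^ n
0<½^ n = ℚ.positive⁻¹ (½ ^ n) {{ ½^-pos n }}

½^-homo-+ : ∀ m n → ½ ^ (m ℕ.+ n) ≡ ½ ^ m * ½ ^ n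
½^-homo-+ zero    n = sym (ℚ.*-identityˡ _)
½^-homo-+ (suc m) n = trans (cong (½ *_) (½^-homo-+ m n)) (sym (ℚ.*-assoc ½ (½ ^ m) (½ ^ n)))

½^-anti-≤ : ∀ {m n} → m ℕ.≤ n → ½ ^ n ≤ ½ ^ m
½^-anti-≤ {m} {n} m≤n with ℕ.m≤n⇒m<n∨m≡n m≤n
½^-anti-≤ {m} {n}     _ | inj₂ refl = ℚ.≤-refl
½^-anti-≤ {m} {suc n} _ | inj₁ (s≤s m≤n) = ℚ.≤-trans (ℚ.<⇒≤ (½^-< n)) (½^-anti-≤ m≤n)

½^-anti-< : ∀ {m n} → m ℕ.< n → ½ ^ n < ½ ^ m
½^-anti-< {m} m<n = ℚ.≤-<-trans (½^-anti-≤ m<n) (½^-< m)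

*½^-small : ∀ h ε → 0ℚ < h → 0ℚ < ε → ∃[ k ] h * ½ ^ k < ε
*½^-small h ε 0<h 0<ε =
  let (k , lt) = ½^-small (1/ h * ε) (subst (_< 1/ h * ε) (ℚ.*-zeroʳ (1/ h)) (ℚ.*-monoʳ-<-pos (1/ h) 0<ε))
  in k , subst (h * ½ ^ k <_)
       (trans (sym (ℚ.*-assoc h (1/ h) ε)) (trans (cong (_* ε) (ℚ.*-inverseʳ h)) (ℚ.*-identityˡ ε)))
       (ℚ.*-monoʳ-<-pos h lt)
  where
  instance
    h-pos = positive 0<h
    h-nonZero = ℚ.pos⇒nonZero h
    1/h-pos = ℚ.1/pos⇒pos h

-- Initial segments, basic open sets and sequences given by rules.

↾-bits : ∀ {x y : Cantor} n → x ↾ n ≡ y ↾ n → ∀ {i} → i ℕ.< n → x i ≡ y i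
↾-bits (suc n) eq {zero}  _         = proj₁ (∷-injective eq)
↾-bits (suc n) eq {suc i} (s≤s i<n) = ↾-bits n (proj₂ (∷-injective eq)) i<n

bits-↾ : ∀ {x y : Cantor} n → (∀ {i} → i ℕ.< n → x i ≡ y i) → x ↾ n ≡ y ↾ n
bits-↾ zero    eq = refl
bits-↾ (suc n) eq = cong₂ _∷_ (eq (s≤s z≤n)) (bits-↾ n (λ i<n → eq (s≤s i<n)))

↾-mono : ∀ {x y : Cantor} {m n} → m ℕ.≤ n → x ↾ n ≡ y ↾ n → x ↾ m ≡ y ↾ m
↾-mono {m = m} {n} m≤n eq = bits-↾ m (λ i<m → ↾-bits n eq (ℕ.<-≤-trans i<m m≤n))

N↾⇒≡ : ∀ {x z : Cantor} n → N (z ↾ n) x → x ↾ n ≡ z ↾ n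
N↾⇒≡ {x} {z} n = subst (λ m → x ↾ m ≡ z ↾ n) (length-applyUpTo z n)

≡⇒N↾ : ∀ {x z : Cantor} n → x ↾ n ≡ z ↾ n → N (z ↾ n) x
≡⇒N↾ {x} {z} n = subst (λ m → x ↾ m ≡ z ↾ n) (sym (length-applyUpTo z n))

½^-length-↾ : ∀ (z : Cantor) n → ½ ^ length (z ↾ n) ≡ ½ ^ n
½^-length-↾ z n = cong (½ ^_) (length-applyUpTo z n)

N-split : ∀ s {x} → N s x → N (s ∷ʳ false) x ⊎ N (s ∷ʳ true) x
N-split [] {x} h with x 0
... | false = inj₁ refl
... | true  = inj₂ refl
N-split (c ∷ s) h with N-split s (proj₂ (∷-injective h))
... | inj₁ h′ = inj₁ (cong₂ _∷_ (proj₁ (∷-injective h)) h′)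
... | inj₂ h′ = inj₂ (cong₂ _∷_ (proj₁ (∷-injective h)) h′)

-- The infinite sequence produced by a rule that reads off the next bit from
-- the bits already written.
run : (List Bool → Bool) → Cantor
run β zero    = β []
run β (suc n) = run (λ u → β (β [] ∷ u)) n

run-step : ∀ β n → run β n ≡ β (run β ↾ n)
run-step β zero    = refl
run-step β (suc n) = run-step (λ u → β (β [] ∷ u)) n

-- Bit `n` is computed from values of the rule at strings of length at most `n`. The continuity of
-- the reduction comes from this.
run-cong : ∀ n {β γ} → (∀ u → length u ℕ.< n → β u ≡ γ u) → run β ↾ n ≡ run γ ↾ n
run-cong zero    β≗γ = refl
run-cong (suc n) {β} {γ} β≗γ = cong₂ _∷_ eq
  (run-cong n (λ u u<n → trans (β≗γ (β [] ∷ u) (s≤s u<n)) (cong (λ b → γ (b ∷ u)) eq)))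
  where eq = β≗γ [] (s≤s z≤n)

infixr 5 _◂_
_◂_ : Bool → Cantor → Cantor
(b ◂ x) zero    = b
(b ◂ x) (suc n) = x n

N-inhabited : ∀ s → ∃[ x ] N s x
N-inhabited []      = (λ _ → false) , refl
N-inhabited (b ∷ s) = let (x , h) = N-inhabited s in b ◂ x , cong (b ∷_) h

-- Covers by basic open sets and their partial sums.

-- This is the measure of the intersection of `N u` and `N s`, obtained by recursion on the strings
-- so that it stays rational.
meet : List Bool → List Bool → ℚ
meet []      s  = ½ ^ length s
meet (b ∷ u) [] = ½ ^ suc (length u)
meet (b ∷ u) (c ∷ s) = if does (b Bool.≟ c) then ½ * meet u s else 0ℚ

0≤½* : ∀ {q} → 0ℚ ≤ q → 0ℚ ≤ ½ * q
0≤½* 0≤q = ℚ.≤-trans (ℚ.≤-reflexive (sym (ℚ.*-zeroʳ ½))) (ℚ.*-monoˡ-≤-nonNeg ½ 0≤q)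

0≤meet : ∀ u s → 0ℚ ≤ meet u s
0≤meet []      s  = 0≤½^ (length s)
0≤meet (b ∷ u) [] = 0≤½^ (suc (length u))
0≤meet (b ∷ u) (c ∷ s) with b Bool.≟ c
... | yes _ = 0≤½* (0≤meet u s)
... | no  _ = ℚ.≤-refl

meet-≤ : ∀ u s → meet u s ≤ ½ ^ length u
meet-≤ []      s  = ½^-anti-≤ {n = length s} z≤n
meet-≤ (b ∷ u) [] = ℚ.≤-refl
meet-≤ (b ∷ u) (c ∷ s) with b Bool.≟ c
... | yes _ = ℚ.*-monoˡ-≤-nonNeg ½ (meet-≤ u s)
... | no  _ = 0≤½^ (suc (length u))

meet-[]ʳ : ∀ u → meet u [] ≡ ½ ^ length u
meet-[]ʳ []      = refl
meet-[]ʳ (b ∷ u) = refl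

length-∷ʳ : ∀ (s : List Bool) b → length (s ∷ʳ b) ≡ suc (length s)
length-∷ʳ s b = trans (length-++ s) (ℕ.+-comm (length s) 1)

½^-length-∷ʳ : ∀ s b → ½ ^ length (s ∷ʳ b) ≡ ½ ^ suc (length s)
½^-length-∷ʳ s b = cong (½ ^_) (length-∷ʳ s b)

meet-∷ʳ : ∀ u s → meet u (s ∷ʳ false) + meet u (s ∷ʳ true) ≡ meet u s
meet-∷ʳ []          s  = trans (cong₂ _+_ (½^-length-∷ʳ s false) (½^-length-∷ʳ s true)) (half (length s))
meet-∷ʳ (false ∷ u) [] = trans (ℚ.+-identityʳ _) (cong (½ *_) (meet-[]ʳ u))
meet-∷ʳ (true ∷ u)  [] = trans (ℚ.+-identityˡ _) (cong (½ *_) (meet-[]ʳ u))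
meet-∷ʳ (b ∷ u) (c ∷ s) with b Bool.≟ c
... | yes _ = trans (sym (ℚ.*-distribˡ-+ ½ (meet u (s ∷ʳ false)) (meet u (s ∷ʳ true)))) (cong (½ *_) (meet-∷ʳ u s))
... | no  _ = refl

meet-prefix : ∀ u {x n} → N u x → length u ℕ.≤ n → meet u (x ↾ n) ≡ ½ ^ n
meet-prefix []      {x} {n} h _ = ½^-length-↾ x n
meet-prefix (b ∷ u) {x} {suc n} h (s≤s le) with b Bool.≟ x 0
... | yes _  = cong (½ *_) (meet-prefix u (proj₂ (∷-injective h)) le)
... | no b≢x = contradiction (sym (proj₁ (∷-injective h))) b≢x

meetSum : (ℕ → List Bool) → List Bool → ℕ → ℚ
meetSum c s zero    = 0ℚ
meetSum c s (suc n) = meet (c 0) s + meetSum (c ∘ suc) s n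

meetSum-≤ : ∀ c s n → meetSum c s n ≤ partialSum c n
meetSum-≤ c s zero    = ℚ.≤-refl
meetSum-≤ c s (suc n) = ℚ.+-mono-≤ (meet-≤ (c 0) s) (meetSum-≤ (c ∘ suc) s n)

0≤meetSum : ∀ c s n → 0ℚ ≤ meetSum c s n
0≤meetSum c s zero    = ℚ.≤-refl
0≤meetSum c s (suc n) = ℚ.+-mono-≤ (0≤meet (c 0) s) (0≤meetSum (c ∘ suc) s n)

meetSum-mono : ∀ c s {m n} → m ℕ.≤ n → meetSum c s m ≤ meetSum c s n
meetSum-mono c s {n = n} z≤n = 0≤meetSum c s n
meetSum-mono c s (s≤s le)    = ℚ.+-monoʳ-≤ (meet (c 0) s) (meetSum-mono (c ∘ suc) s le)

meet-≤-meetSum : ∀ c s i → meet (c i) s ≤ meetSum c s (suc i)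
meet-≤-meetSum c s zero    = ℚ.≤-reflexive (sym (ℚ.+-identityʳ _))
meet-≤-meetSum c s (suc i) = ℚ.≤-trans (meet-≤-meetSum (c ∘ suc) s i)
  (gap-≤ (meet (c 0) s) (0≤meet (c 0) s) (ℚ.+-comm _ (meet (c 0) s)))

meetSum-∷ʳ : ∀ c s n → meetSum c (s ∷ʳ false) n + meetSum c (s ∷ʳ true) n ≡ meetSum c s n
meetSum-∷ʳ c s zero    = refl
meetSum-∷ʳ c s (suc n) =
  trans (solve 4 (λ a b d e → (a :+ b) :+ (d :+ e) := (a :+ d) :+ (b :+ e)) refl
           (meet (c 0) (s ∷ʳ false)) (meetSum (c ∘ suc) (s ∷ʳ false) n) (meet (c 0) (s ∷ʳ true)) _)
        (cong₂ _+_ (meet-∷ʳ (c 0) s) (meetSum-∷ʳ (c ∘ suc) s n))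
  where open +-*-Solver

partialSum-mono : ∀ c {m n} → m ℕ.≤ n → partialSum c m ≤ partialSum c n
partialSum-mono c {n = zero}  z≤n = ℚ.≤-refl
partialSum-mono c {n = suc n} z≤n = ℚ.≤-trans (partialSum-mono c {n = n} z≤n) (partialSum-suc c n)
partialSum-mono c (s≤s le) = ℚ.+-monoʳ-≤ (½ ^ length (c 0)) (partialSum-mono (c ∘ suc) le)

partialSum-+ : ∀ c m n → partialSum c m + partialSum (λ i → c (m ℕ.+ i)) n ≡ partialSum c (m ℕ.+ n)
partialSum-+ c zero    n = ℚ.+-identityˡ _
partialSum-+ c (suc m) n = trans (ℚ.+-assoc (½ ^ length (c 0)) (partialSum (c ∘ suc) m) _)
                                 (cong (½ ^ length (c 0) +_) (partialSum-+ (c ∘ suc) m n))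

μ-⊆∪ : ∀ {X Y Z} {a b q : ℚ} → X ⊆ Y ∪ Z → μ Y ≺ a → μ Z ≺ b → a + b ≤ q → μ X ≺ q
μ-⊆∪ {Y = Y} {Z} X⊆ Y≺a Z≺b le = μ-mono X⊆ (μ-∪ {Y} {Z} (_ , _ , Y≺a , Z≺b , le))

-- Covers are infinite sequences, so `s` is followed by the strings `tiny k i`, whose total weight
-- fits into the slack `q - ½ ^ length s`.
μN-≺ : ∀ s {q} → ½ ^ length s < q → μ (N s) ≺ q
μN-≺ s {q} lt = let (k , small) = ½^-small (q - ½ ^ length s) (p<q⇒0<q-p lt) in
  c k , (λ h → 0 , h) , ½ ^ length s + ½ ^ k
  , subst (½ ^ length s + ½ ^ k <_) (solve 2 (λ a b → a :+ (b :- a) := b) refl (½ ^ length s) q)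
      (ℚ.+-monoʳ-< (½ ^ length s) small)
  , bound k
  where
  open +-*-Solver
  c : ℕ → ℕ → List Bool
  c k zero    = s
  c k (suc i) = tiny k i
  bound : ∀ k n → partialSum (c k) n ≤ ½ ^ length s + ½ ^ k
  bound k zero    = ℚ.+-mono-≤ (0≤½^ (length s)) (0≤½^ k)
  bound k (suc n) = ℚ.+-monoʳ-≤ (½ ^ length s) (partialSum-tiny k n)

split : (ℕ → List Bool) → ℕ → List Bool
split c zero          = c 0 ∷ʳ false
split c (suc zero)    = c 0 ∷ʳ true
split c (suc (suc i)) = split (c ∘ suc) i

split-covers : ∀ c → ⋃ ℕ (N ∘ c) ⊆ ⋃ ℕ (N ∘ split c)
split-covers c (zero , h) with N-split (c 0) h
... | inj₁ h′ = 0 , h′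
... | inj₂ h′ = 1 , h′
split-covers c (suc i , h) = let (j , h′) = split-covers (c ∘ suc) (i , h) in suc (suc j) , h′

split-length : ∀ c {m} → (∀ i → m ℕ.≤ length (c i)) → ∀ i → suc m ℕ.≤ length (split c i)
split-length c le zero          = ℕ.≤-trans (s≤s (le 0)) (ℕ.≤-reflexive (sym (length-∷ʳ (c 0) false)))
split-length c le (suc zero)    = ℕ.≤-trans (s≤s (le 0)) (ℕ.≤-reflexive (sym (length-∷ʳ (c 0) true)))
split-length c le (suc (suc i)) = split-length (c ∘ suc) (le ∘ suc) i

-- Two siblings together weigh as much as their parent, so `n` entries weigh at most as much as
-- their parents, of which there are no more than `n`.
partialSum-split : ∀ c n → partialSum (split c) n ≤ partialSum c n
partialSum-split c zero          = ℚ.≤-refl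
partialSum-split c (suc zero)    = ℚ.+-monoˡ-≤ 0ℚ
  (ℚ.≤-trans (ℚ.≤-reflexive (½^-length-∷ʳ (c 0) false)) (ℚ.<⇒≤ (½^-< (length (c 0)))))
partialSum-split c (suc (suc n)) = begin
  ½ ^ length (c 0 ∷ʳ false) + (½ ^ length (c 0 ∷ʳ true) + partialSum (split (c ∘ suc)) n)
    ≡⟨ cong₂ (λ a b → a + (b + partialSum (split (c ∘ suc)) n)) (½^-length-∷ʳ (c 0) false) (½^-length-∷ʳ (c 0) true) ⟩
  w + (w + partialSum (split (c ∘ suc)) n)
    ≡⟨ sym (ℚ.+-assoc w w _) ⟩
  (w + w) + partialSum (split (c ∘ suc)) n
    ≡⟨ cong (_+ partialSum (split (c ∘ suc)) n) (half (length (c 0))) ⟩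
  ½ ^ length (c 0) + partialSum (split (c ∘ suc)) n
    ≤⟨ ℚ.+-monoʳ-≤ (½ ^ length (c 0)) (partialSum-split (c ∘ suc) n) ⟩
  ½ ^ length (c 0) + partialSum (c ∘ suc) n
    ≤⟨ ℚ.+-monoʳ-≤ (½ ^ length (c 0)) (partialSum-suc (c ∘ suc) n) ⟩
  ½ ^ length (c 0) + partialSum (c ∘ suc) (suc n) ∎
  where
  open ℚ.≤-Reasoning
  w = ½ ^ suc (length (c 0))

-- For a set decided by the first `m` bits, every member of the refined cover lies inside the set or
-- misses it.
refine : ∀ m c → ∃[ c′ ] (⋃ ℕ (N ∘ c) ⊆ ⋃ ℕ (N ∘ c′)) × (∀ i → m ℕ.≤ length (c′ i))
                         × (∀ n → partialSum c′ n ≤ partialSum c n)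
refine zero    c = c , (λ h → h) , (λ _ → z≤n) , (λ _ → ℚ.≤-refl)
refine (suc m) c = let (c′ , cov , len , le) = refine m c in
  split c′ , (λ h → split-covers c′ (cov h)) , split-length c′ len
  , λ n → ℚ.≤-trans (partialSum-split c′ n) (le n)

-- The strings not selected are replaced by tiny ones, to keep a sequence.
select : (List Bool → Bool) → ℕ → (ℕ → List Bool) → ℕ → List Bool
select b k c i = if b (c i) then c i else tiny k i

-- At each index one of the two selections takes `c i` and the other takes the tiny replacement.
partialSum-select : ∀ b k c n →
  partialSum (select b k c) n + partialSum (select (not ∘ b) k c) n ≡ partialSum c n + partialSum (tiny k) n
partialSum-select b k c zero    = refl
partialSum-select b k c (suc n) with b (c 0)
... | true  = trans (solve 4 (λ u v w z → (u :+ v) :+ (w :+ z) := (u :+ w) :+ (v :+ z)) refl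
                      (½ ^ length (c 0)) (partialSum (select b (suc k) (c ∘ suc)) n) (½ ^ length (tiny k 0)) _)
             (trans (cong (½ ^ length (c 0) + ½ ^ length (tiny k 0) +_) (partialSum-select b (suc k) (c ∘ suc) n))
               (solve 4 (λ u v w z → (u :+ v) :+ (w :+ z) := (u :+ w) :+ (v :+ z)) refl
                      (½ ^ length (c 0)) (½ ^ length (tiny k 0)) (partialSum (c ∘ suc) n) _))
  where open +-*-Solver
... | false = trans (solve 4 (λ u v w z → (u :+ v) :+ (w :+ z) := (w :+ u) :+ (v :+ z)) refl
                      (½ ^ length (tiny k 0)) (partialSum (select b (suc k) (c ∘ suc)) n) (½ ^ length (c 0)) _)
             (trans (cong (½ ^ length (c 0) + ½ ^ length (tiny k 0) +_) (partialSum-select b (suc k) (c ∘ suc) n))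
               (solve 4 (λ u v w z → (u :+ v) :+ (w :+ z) := (u :+ w) :+ (v :+ z)) refl
                      (½ ^ length (c 0)) (½ ^ length (tiny k 0)) (partialSum (c ∘ suc) n) _))
  where open +-*-Solver

module _ (em : ExcludedMiddle 0ℓ) where

  ¬∀⇒∃¬ : ∀ {A : Set} {P : Pred A 0ℓ} → ¬ (∀ x → P x) → ∃[ x ] ¬ P x
  ¬∀⇒∃¬ ¬∀ = decidable-stable em λ ¬∃ → ¬∀ λ x → decidable-stable em λ ¬p → ¬∃ (x , ¬p)

  truth : Set → Bool
  truth P = does (em {P})

  truth⇒ : ∀ {P} → truth P ≡ true → P
  truth⇒ {P} eq with em {P}
  ... | yes p = p

  truth-cong : ∀ {P Q} → (P → Q) → (Q → P) → truth P ≡ truth Q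
  truth-cong {P} {Q} to from with em {P} | em {Q}
  ... | yes _ | yes _ = refl
  ... | no  _ | no  _ = refl
  ... | yes p | no ¬q = contradiction (to p) ¬q
  ... | no ¬p | yes q = contradiction (from q) ¬p

  -- Infinite branches and the measure of basic open sets.

  -- The branch goes left whenever `B` survives there; otherwise `step` provides it on the right.
  branch₀ : (B : Pred (List Bool) 0ℓ) → (∀ u → B u → B (u ∷ʳ false) ⊎ B (u ∷ʳ true)) →
            B [] → ∃[ x ] ∀ n → B (x ↾ n)
  branch₀ B step B[] = run β , λ n → go n
    where
    β : List Bool → Bool
    β u = not (truth (B (u ∷ʳ false)))
    choose : ∀ u → B u → B (u ∷ʳ β u)
    choose u Bu with em {B (u ∷ʳ false)} | step u Bu
    ... | yes b | _      = b
    ... | no ¬b | inj₁ b = contradiction b ¬b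
    ... | no _  | inj₂ b = b
    go : ∀ n → B (run β ↾ n)
    go zero    = B[]
    go (suc n) = subst B (trans (cong (run β ↾ n ∷ʳ_) (sym (run-step β n))) (applyUpTo-∷ʳ (run β) n))
                         (choose (run β ↾ n) (go n))

  branch : (B : Pred (List Bool) 0ℓ) → (∀ u → B u → B (u ∷ʳ false) ⊎ B (u ∷ʳ true)) →
           ∀ s → B s → ∃[ x ] N s x × ∀ n → length s ℕ.≤ n → B (x ↾ n)
  branch B step []      Bs = let (x , Bx) = branch₀ B step Bs in x , refl , λ n _ → Bx n
  branch B step (b ∷ s) Bs =
    let (x , Nsx , Bx) = branch (λ u → B (b ∷ u)) (λ u → step (b ∷ u)) s Bs
    in  b ◂ x , cong (b ∷_) Nsx , λ { (suc n) (s≤s le) → Bx n le }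

  -- Compactness of N s: if a cover had too small a sum, some branch through s
  -- would consist of strings that the cover does not exhaust.
  ¬μN-≺ : ∀ s → ¬ (μ (N s) ≺ ½ ^ length s)
  ¬μN-≺ s (c , cov , r , r< , le) =
    let (x , Nsx , Bx) = branch B step s (λ n → ℚ.≤-<-trans (ℚ.≤-trans (meetSum-≤ c s n) (le n)) r<)
        (i , h) = cov Nsx
        n = length s ℕ.⊔ length (c i)
    -- For this `n` the set `N (x ↾ n)` lies inside `N (c i)`, so that single term already weighs
    -- `½ ^ n`.
    in  <⇒≱ (Bx n (ℕ.m≤m⊔n _ _) (suc i))
          (ℚ.≤-trans (ℚ.≤-reflexive (trans (½^-length-↾ x n) (sym (meet-prefix (c i) h (ℕ.m≤n⊔m (length s) _)))))
                     (meet-≤-meetSum c (x ↾ n) i))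
    where
    B : Pred (List Bool) 0ℓ
    B u = ∀ n → meetSum c u n < ½ ^ length u
    step : ∀ u → B u → B (u ∷ʳ false) ⊎ B (u ∷ʳ true)
    step u Bu with em {B (u ∷ʳ false)} | em {B (u ∷ʳ true)}
    ... | yes b | _     = inj₁ b
    ... | no _  | yes b = inj₂ b
    ... | no ¬b | no ¬b′ =
      let (m , ¬m) = ¬∀⇒∃¬ ¬b
          (n , ¬n) = ¬∀⇒∃¬ ¬b′
          open ℚ.≤-Reasoning
      in  ⊥-elim (<⇒≱ (Bu (m ℕ.⊔ n)) (begin
            ½ ^ length u
              ≡⟨ sym (half (length u)) ⟩
            ½ ^ suc (length u) + ½ ^ suc (length u)
              ≡⟨ sym (cong₂ _+_ (½^-length-∷ʳ u false) (½^-length-∷ʳ u true)) ⟩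
            ½ ^ length (u ∷ʳ false) + ½ ^ length (u ∷ʳ true)
              ≤⟨ ℚ.+-mono-≤ (ℚ.≮⇒≥ ¬m) (ℚ.≮⇒≥ ¬n) ⟩
            meetSum c (u ∷ʳ false) m + meetSum c (u ∷ʳ true) n
              ≤⟨ ℚ.+-mono-≤ (meetSum-mono c (u ∷ʳ false) (ℕ.m≤m⊔n m n)) (meetSum-mono c (u ∷ʳ true) (ℕ.m≤n⊔m m n)) ⟩
            meetSum c (u ∷ʳ false) (m ℕ.⊔ n) + meetSum c (u ∷ʳ true) (m ℕ.⊔ n)
              ≡⟨ meetSum-∷ʳ c u (m ℕ.⊔ n) ⟩
            meetSum c u (m ℕ.⊔ n) ∎))

  -- Infima and suprema up to a rational error.

  ½-step : ∀ h p → ½ * h * p ≡ h * (½ * p)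
  ½-step h p = trans (cong (_* p) (ℚ.*-comm ½ h)) (ℚ.*-assoc h ½ p)

  -- The interval is given by its upper end and its width; `B` holds at the upper end and fails at
  -- the lower end throughout the bisection.
  bisect : ∀ (B : Pred ℚ 0ℓ) hi h k → B hi → ¬ B (hi - h) → ∃[ r ] B r × ¬ B (r - h * ½ ^ k)
  bisect B hi h zero    Bhi ¬Blo = hi , Bhi , subst (λ z → ¬ B (hi - z)) (sym (ℚ.*-identityʳ h)) ¬Blo
  bisect B hi h (suc k) Bhi ¬Blo with em {B (hi - ½ * h)}
  ... | yes Bmid = let (r , Br , ¬Br) = bisect B (hi - ½ * h) (½ * h) k Bmid (subst (λ z → ¬ B z) lo≡ ¬Blo)
                   in  r , Br , subst (λ z → ¬ B (r - z)) (½-step h (½ ^ k)) ¬Br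
    where
    open +-*-Solver
    lo≡ : hi - h ≡ hi - ½ * h - ½ * h
    lo≡ = trans (cong (λ z → hi - z) (sym (½*+½* h)))
                (solve 2 (λ x y → x :- (y :+ y) := x :- y :- y) refl hi (½ * h))
  ... | no ¬Bmid = let (r , Br , ¬Br) = bisect B hi (½ * h) k Bhi ¬Bmid
                   in  r , Br , subst (λ z → ¬ B (r - z)) (½-step h (½ ^ k)) ¬Br

  -- The infimum of `B` need not be rational; a rational within `η` of it serves instead. Bisecting
  -- between `lo` and `hi` finds one.
  near-infimum : ∀ (B : Pred ℚ 0ℓ) → (∀ {p q} → p ≤ q → B p → B q) →
                 ∀ {lo hi} → B hi → ¬ B lo → ∀ {η} → 0ℚ < η → ∃[ r ] B r × ¬ B (r - η)
  near-infimum B up {lo} {hi} Bhi ¬Blo {η} 0<η =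
    let 0<h = p<q⇒0<q-p (ℚ.≰⇒> λ hi≤lo → ¬Blo (up hi≤lo Bhi))
        (k , small) = *½^-small (hi - lo) η 0<h 0<η
        (r , Br , ¬Br) = bisect B hi (hi - lo) k Bhi
          (subst (λ z → ¬ B z) (solve 2 (λ x y → y := x :- (x :- y)) refl hi lo) ¬Blo)
    in  r , Br , λ b → ¬Br (up (ℚ.+-monoʳ-≤ r (ℚ.neg-antimono-≤ (ℚ.<⇒≤ small))) b)
    where open +-*-Solver

  near-supremum : ∀ (S : ℕ → ℚ) {R} → 0ℚ ≤ S 0 → (∀ n → S n ≤ R) → ∀ {η} → 0ℚ < η →
                  ∃[ r ] (∀ n → S n ≤ r) × (∃[ n ] r - η < S n)
  near-supremum S {R} 0≤S S≤R {η} 0<η =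
    -- The supremum is the infimum of the upper bounds, and `- 1ℚ` is not an upper bound because
    -- `S 0` is nonnegative.
    let (r , S≤r , ¬S≤) = near-infimum (λ r → ∀ n → S n ≤ r) (λ p≤q S≤p n → ℚ.≤-trans (S≤p n) p≤q)
                            {lo = - 1ℚ} S≤R (λ S≤ → case ℚ.≤-trans 0≤S (S≤ 0) of λ { (*≤* ()) }) 0<η
        (n , S≰) = ¬∀⇒∃¬ ¬S≤
    in  r , S≤r , n , ℚ.≰⇒> S≰

  -- Measurability of clopen sets.

  Determined : ℕ → Pred Cantor 0ℓ → Set
  Determined m P = ∀ {x y} → x ↾ m ≡ y ↾ m → P x → P y

  -- After refinement to strings of length at least `m`, a cover of `E` separates into a cover of
  -- the part inside `P` and one of the part outside, and their weights add up to the old one apart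
  -- from the tiny replacements.
  determined⇒measurable : ∀ {P} m → Determined m P → Measurable P
  determined⇒measurable {P} m det E = to , from
    where
    from : ∀ {q} → (μ (E ∩ P) ⊕ μ (E ∖ P)) ≺ q → μ E ≺ q
    from h = μ-mono (λ {x} x∈E → case em {P x} of λ { (yes p) → inj₁ (x∈E , p) ; (no ¬p) → inj₂ (x∈E , ¬p) })
                    (μ-∪ {E ∩ P} {E ∖ P} h)

    to : ∀ {q} → μ E ≺ q → (μ (E ∩ P) ⊕ μ (E ∖ P)) ≺ q
    to {q} (c₀ , cov₀ , r , r<q , le₀) =
      -- Only the sum of the two weights is bounded. The near-supremum `r₁` fixes the share of the
      -- first; from `n₁` on this share is almost used up, so every partial sum of the second fits
      -- into the rest.
      let (r₁ , S₁≤ , n₁ , S₁>) = near-supremum S₁ {r + ½ ^ k} ℚ.≤-refl (λ n → ℚ.≤-trans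
            (gap-≤ (S₂ n) (partialSum-mono (select (not ∘ b) k c) {n = n} z≤n) refl) (S₁+S₂≤ n)) 0<η
      in  r₁ + η , q - (r₁ + η)
        , (select b k c , cov₁ , r₁ , gap-< η 0<η refl , S₁≤)
        , (select (not ∘ b) k c , cov₂ , q - (r₁ + η + ζ)
            , gap-< ζ (0<½* 0<η) (solve 3 (λ x y z → x :- (y :+ z) :+ z := x :- y) refl q (r₁ + η) ζ)
            , S₂≤ r₁ n₁ S₁>)
        , ℚ.≤-reflexive (solve 2 (λ x y → x :+ (y :- x) := y) refl (r₁ + η) q)
      where
      open +-*-Solver
      fine = refine m c₀
      c = proj₁ fine
      len = proj₁ (proj₂ (proj₂ fine))
      -- The slack `q - r` equals `4η`, and `η` is `2ζ`. The estimate for `S₂` needs `2η + 2ζ`,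
      -- which is `3η`, and gives the last `η` away.
      θ = ½ * (q - r)
      η = ½ * θ
      ζ = ½ * η
      0<η : 0ℚ < η
      0<η = 0<½* (0<½* (p<q⇒0<q-p r<q))
      small = ½^-small ζ (0<½* 0<η)
      k = proj₁ small
      -- Marks the strings whose neighbourhood meets `P`; at length `m` or more such a neighbourhood
      -- is contained in `P`.
      b : List Bool → Bool
      b u = truth (∃[ x ] N u x × P x)
      S₁ = partialSum (select b k c)
      S₂ = partialSum (select (not ∘ b) k c)
      S₁+S₂≤ : ∀ n → S₁ n + S₂ n ≤ r + ½ ^ k
      S₁+S₂≤ n = ℚ.≤-trans (ℚ.≤-reflexive (partialSum-select b k c n))
        (ℚ.+-mono-≤ (ℚ.≤-trans (proj₂ (proj₂ (proj₂ fine)) n) (le₀ n)) (partialSum-tiny k n))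
      S₂≤ : ∀ r₁ n₁ → r₁ - η < S₁ n₁ → ∀ n → S₂ n ≤ q - (r₁ + η + ζ)
      S₂≤ r₁ n₁ S₁> n = begin
        S₂ n                                        ≤⟨ partialSum-mono (select (not ∘ b) k c) (ℕ.m≤n⊔m n₁ n) ⟩
        S₂ M                                        ≡⟨ solve 2 (λ x y → y := x :+ y :- x) refl (S₁ M) (S₂ M) ⟩
        S₁ M + S₂ M - S₁ M                          ≤⟨ ℚ.+-mono-≤ (S₁+S₂≤ M) (ℚ.neg-antimono-≤
                                                         (ℚ.≤-trans (ℚ.<⇒≤ S₁>) (partialSum-mono (select b k c) (ℕ.m≤m⊔n n₁ n)))) ⟩
        r + ½ ^ k - (r₁ - η)                        ≤⟨ ℚ.+-monoˡ-≤ (- (r₁ - η)) (ℚ.+-monoʳ-≤ r (ℚ.<⇒≤ (proj₂ small))) ⟩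
        r + ζ - (r₁ - η)                          ≤⟨ gap-≤ η (ℚ.<⇒≤ 0<η) refl ⟩
        r + ζ - (r₁ - η) + η                      ≡⟨ solve 4 (λ r h r₁ e → r :+ h :- (r₁ :- e) :+ e :=
                                                         (r :+ ((e :+ e) :+ ((h :+ h) :+ e))) :- (r₁ :+ e :+ h)) refl r ζ r₁ η ⟩
        r + ((η + η) + ((ζ + ζ) + η)) - (r₁ + η + ζ)
          ≡⟨ cong (λ z → r + ((η + η) + (z + η)) - (r₁ + η + ζ)) (½*+½* η) ⟩
        r + ((η + η) + (η + η)) - (r₁ + η + ζ)    ≡⟨ cong (λ z → r + (z + z) - (r₁ + η + ζ)) (½*+½* θ) ⟩
        r + (θ + θ) - (r₁ + η + ζ)          ≡⟨ cong (λ z → r + z - (r₁ + η + ζ)) (½*+½* (q - r)) ⟩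
        r + (q - r) - (r₁ + η + ζ)                ≡⟨ cong (_- (r₁ + η + ζ))
                                                         (solve 2 (λ x y → x :+ (y :- x) := y) refl r q) ⟩
        q - (r₁ + η + ζ)                          ∎
        where
        open ℚ.≤-Reasoning
        M = n₁ ℕ.⊔ n
      cov₁ : E ∩ P ⊆ ⋃ ℕ (N ∘ select b k c)
      cov₁ {x} (x∈E , Px) =
        let (i , h) = proj₁ (proj₂ fine) (cov₀ x∈E)
        in  i , subst (λ z → N (if z then c i else tiny k i) x) (sym (dec-true em (x , h , Px))) h
      cov₂ : E ∖ P ⊆ ⋃ ℕ (N ∘ select (not ∘ b) k c)
      cov₂ {x} (x∈E , ¬Px) =
        let (i , h) = proj₁ (proj₂ fine) (cov₀ x∈E)
        in  i , subst (λ z → N (if not z then c i else tiny k i) x)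
                  (sym (dec-false em λ (y , h′ , Py) → ¬Px (det (↾-mono (len i) (trans h′ (sym h))) Py))) h

  -- Approximation of measurable sets by clopen sets.

  Upto : (ℕ → List Bool) → ℕ → Pred Cantor 0ℓ
  Upto c k x = ∃[ i ] i ℕ.≤ k × N (c i) x

  remainder-≤ : ∀ {a b q η} → q - η < a → a + b ≤ q → b ≤ η
  remainder-≤ {a} {b} {q} {η} lt le = begin
    b           ≡⟨ solve 2 (λ a b → b := a :+ b :- a) refl a b ⟩
    a + b - a   ≤⟨ ℚ.+-mono-≤ le (ℚ.neg-antimono-≤ (ℚ.<⇒≤ lt)) ⟩
    q - (q - η) ≡⟨ solve 2 (λ q e → q :- (q :- e) := e) refl q η ⟩
    η           ∎
    where
    open +-*-Solver
    open ℚ.≤-Reasoning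

  -- Take a cover whose weight is within `η` of the measure of `A`. Carathéodory's criterion, tested
  -- on the union of the cover, turns this excess of weight into a bound for the measure of the
  -- difference.
  open-approximation : ∀ A {η} → 0ℚ < η → ∃[ c ] ∃[ r ] set A ⊆ ⋃ ℕ (N ∘ c) ×
                       (∀ n → partialSum c n ≤ r) × μ (⋃ ℕ (N ∘ c) ∖ set A) ≺ η
  open-approximation A {η} 0<η = cover (near-infimum (μ (set A) ≺_) (upper (μ (set A))) {lo = 0ℚ}
    -- The whole space has measure `1ℚ`, and a cut needs a strictly larger bound, hence `1ℚ + 1ℚ`.
    (μ-mono {B = N []} (λ _ → refl) (μN-≺ [] {1ℚ + 1ℚ} (gap-< 1ℚ (ℚ.positive⁻¹ 1ℚ) refl)))
    (λ h → ℚ.<-irrefl refl (0≼μ {set A} h)) 0<η)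
    where
    excess : ∀ c {q} → set A ⊆ ⋃ ℕ (N ∘ c) → ¬ (μ (set A) ≺ q - η) → μ (⋃ ℕ (N ∘ c)) ≺ q →
             μ (⋃ ℕ (N ∘ c) ∖ set A) ≺ η
    excess c cov ¬μA≺ μG≺q with proj₁ (measurable A (⋃ ℕ (N ∘ c))) μG≺q
    ... | a , b , G∩A≺a , G∖A≺b , a+b≤q = upper (μ (⋃ ℕ (N ∘ c) ∖ set A)) (remainder-≤ q-η<a a+b≤q) G∖A≺b
      where q-η<a = ℚ.≰⇒> λ a≤ → ¬μA≺ (upper (μ (set A)) a≤ (μ-mono (λ x∈A → cov x∈A , x∈A) G∩A≺a))
    cover : ∃[ q ] μ (set A) ≺ q × ¬ (μ (set A) ≺ q - η) → ∃[ c ] ∃[ r ] set A ⊆ ⋃ ℕ (N ∘ c) ×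
            (∀ n → partialSum c n ≤ r) × μ (⋃ ℕ (N ∘ c) ∖ set A) ≺ η
    cover (q , (c , cov , r , r<q , le) , ¬μA≺) =
      c , r , cov , le , excess c cov ¬μA≺ (c , (λ h → h) , r , r<q , le)

  small-tail : ∀ c {r} → (∀ n → partialSum c n ≤ r) → ∀ {ε} → 0ℚ < ε →
               ∃[ n ] μ (⋃ ℕ λ i → N (c (n ℕ.+ i))) ≺ ε
  small-tail c S≤r {ε} 0<ε = tail (near-supremum (partialSum c) ℚ.≤-refl S≤r 0<η)
    where
    η = ½ * ε
    0<η : 0ℚ < η
    0<η = 0<½* 0<ε
    tail : ∃[ r ] (∀ n → partialSum c n ≤ r) × (∃[ n ] r - η < partialSum c n) →
           ∃[ n ] μ (⋃ ℕ λ i → N (c (n ℕ.+ i))) ≺ ε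
    tail (r , S≤ , n , S>) = n , (λ i → c (n ℕ.+ i)) , (λ h → h) , η , gap-< η 0<η (½*+½* ε)
      , λ m → remainder-≤ {a = partialSum c n} S> (ℚ.≤-trans (ℚ.≤-reflexive (partialSum-+ c n m)) (S≤ (n ℕ.+ m)))

  -- The finite union differs from `A` only within the excess of the open cover over `A` and the
  -- tail of the cover, each given half of `ε`.
  clopen-approximation : ∀ A {ε} → 0ℚ < ε → ∃[ c ] ∃[ k ] μ (set A △ Upto c k) ≺ ε
  clopen-approximation A {ε} 0<ε = truncate (open-approximation A (0<½* 0<ε))
    where
    tail : ∀ c n {x} → x ∈ ⋃ ℕ (N ∘ c) → ¬ Upto c n x → ∃[ i ] N (c (n ℕ.+ i)) x
    tail c n {x} (i , h) x∉ with i ℕ.≤? n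
    ... | yes i≤n = contradiction (i , i≤n , h) x∉
    ... | no i≰n  = i ℕ.∸ n , subst (λ j → N (c j) x) (sym (ℕ.m+[n∸m]≡n (ℕ.≰⇒≥ i≰n))) h
    incl : ∀ c n → set A ⊆ ⋃ ℕ (N ∘ c) →
           set A △ Upto c n ⊆ (⋃ ℕ (N ∘ c) ∖ set A) ∪ (⋃ ℕ λ i → N (c (n ℕ.+ i)))
    incl c n cov (inj₁ (x∈A , x∉)) = inj₂ (tail c n (cov x∈A) x∉)
    incl c n cov (inj₂ ((i , _ , h) , x∉A)) = inj₁ ((i , h) , x∉A)
    truncate : ∃[ c ] ∃[ r ] set A ⊆ ⋃ ℕ (N ∘ c) × (∀ n → partialSum c n ≤ r) ×
               μ (⋃ ℕ (N ∘ c) ∖ set A) ≺ ½ * ε → ∃[ c ] ∃[ k ] μ (set A △ Upto c k) ≺ ε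
    truncate (c , r , cov , le , G∖A≺) =
      let (n , T≺) = small-tail c le (0<½* 0<ε)
      in  c , n , μ-⊆∪ {a = ½ * ε} {½ * ε} {ε} (incl c n cov) G∖A≺ T≺ (ℚ.≤-reflexive (½*+½* ε))

  -- Patterns and their holes.

  Hole : ℕ → Pred Cantor 0ℓ
  Hole l x = ∀ k → k ℕ.< l → x (l ℕ.+ k) ≡ false

  -- The strings of length l marked by b, each deprived of the hole s 0^l.
  Pattern : ℕ → (List Bool → Bool) → Pred Cantor 0ℓ
  Pattern l b x = b (x ↾ l) ≡ true × (∃[ k ] k ℕ.< l × x (l ℕ.+ k) ≡ true)

  Pattern-determined : ∀ l b → Determined (l ℕ.+ l) (Pattern l b)
  Pattern-determined l b eq (marked , k , k<l , one) =
      trans (cong b (sym (↾-mono (ℕ.m≤m+n l l) eq))) marked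
    , k , k<l , trans (sym (↾-bits (l ℕ.+ l) eq (ℕ.+-monoʳ-< l k<l))) one

  patternSet : ℕ → (List Bool → Bool) → MeasurableSet
  patternSet l b = record
    { set = Pattern l b ; measurable = determined⇒measurable (l ℕ.+ l) (Pattern-determined l b) }

  unpatterned⇒Hole : ∀ {l b x} → b (x ↾ l) ≡ true → ¬ Pattern l b x → Hole l x
  unpatterned⇒Hole {l} {b} {x} marked ∉ k k<l with x (l ℕ.+ k) in eq
  ... | false = refl
  ... | true  = contradiction (marked , k , k<l , eq) ∉

  -- With `s = z ↾ l`, the hole string `s 0^l` is `fill l z ↾ (l + l)`; as a restriction of a point
  -- it is open to the lemmas on `↾`.
  fill : ℕ → Cantor → Cantor
  fill m z i = if does (i ℕ.<? m) then z i else false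

  fill-< : ∀ m z {i} → i ℕ.< m → fill m z i ≡ z i
  fill-< m z {i} i<m = cong (λ b → if b then z i else false) (dec-true (i ℕ.<? m) i<m)

  fill-≥ : ∀ m z {i} → m ℕ.≤ i → fill m z i ≡ false
  fill-≥ m z {i} m≤i = cong (λ b → if b then z i else false) (dec-false (i ℕ.<? m) (ℕ.≤⇒≯ m≤i))

  Hole⇒N-fill : ∀ l {x z} → x ↾ l ≡ z ↾ l → Hole l x → N (fill l z ↾ (l ℕ.+ l)) x
  Hole⇒N-fill l {x} {z} eq hole = ≡⇒N↾ (l ℕ.+ l) (bits-↾ (l ℕ.+ l) bit)
    where
    bit : ∀ {i} → i ℕ.< l ℕ.+ l → x i ≡ fill l z i
    bit {i} i<2l with i ℕ.<? l
    ... | yes i<l = trans (↾-bits l eq i<l) (sym (fill-< l z i<l))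
    ... | no i≮l  = trans (subst (λ j → x j ≡ false) (ℕ.m+[n∸m]≡n l≤i)
        (hole (i ℕ.∸ l) (ℕ.+-cancelˡ-< l (i ℕ.∸ l) l (subst (ℕ._< l ℕ.+ l) (sym (ℕ.m+[n∸m]≡n l≤i)) i<2l))))
        (sym (fill-≥ l z l≤i))
      where l≤i = ℕ.≮⇒≥ i≮l

  -- Lower bounds for densities.

  -- Reals are upper cuts, so density at least `q` is expressed by denying `≺ q`: here `q` is a
  -- lower bound of the density.
  Low : Pred Cantor 0ℓ → List Bool → ℚ → Set
  Low A u q = ¬ (density A u ≺ q)

  Low-antitone : ∀ A u {p q} → p ≤ q → Low A u q → Low A u p
  Low-antitone A u p≤q low h = low (upper (density A u) p≤q h)

  -- The density at `u` is at most the mean of the densities at its two halves, by subadditivity.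
  Low-split : ∀ A u q → Low A u q → Low A (u ∷ʳ false) q ⊎ Low A (u ∷ʳ true) q
  Low-split A u q low with em {density A (u ∷ʳ false) ≺ q} | em {density A (u ∷ʳ true) ≺ q}
  ... | no ¬h | _      = inj₁ ¬h
  ... | yes _ | no ¬h  = inj₂ ¬h
  ... | yes h | yes h′ = contradiction
    (μ-⊆∪ {Y = A ∩ N (u ∷ʳ false)} {A ∩ N (u ∷ʳ true)} incl h h′ (ℚ.≤-reflexive eq)) low
    where
    incl : A ∩ N u ⊆ (A ∩ N (u ∷ʳ false)) ∪ (A ∩ N (u ∷ʳ true))
    incl (x∈A , h) with N-split u h
    ... | inj₁ h′ = inj₁ (x∈A , h′)
    ... | inj₂ h′ = inj₂ (x∈A , h′)
    eq : q * ½ ^ length (u ∷ʳ false) + q * ½ ^ length (u ∷ʳ true) ≡ q * ½ ^ length u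
    eq = trans (sym (ℚ.*-distribˡ-+ q _ (½ ^ length (u ∷ʳ true)))) (cong (q *_)
           (trans (cong₂ _+_ (½^-length-∷ʳ u false) (½^-length-∷ʳ u true)) (half (length u))))

  density-↾ : ∀ A z n q → μ (A ∩ N (z ↾ n)) ≺ q * ½ ^ n → density A (z ↾ n) ≺ q
  density-↾ A z n q = subst (λ p → μ (A ∩ N (z ↾ n)) ≺ q * p) (sym (½^-length-↾ z n))

  density-↾⁻¹ : ∀ A z n q → density A (z ↾ n) ≺ q → μ (A ∩ N (z ↾ n)) ≺ q * ½ ^ n
  density-↾⁻¹ A z n q = subst (λ p → μ (A ∩ N (z ↾ n)) ≺ q * p) (½^-length-↾ z n)

  μN↾-≺ : ∀ z n {q} → ½ ^ n < q → μ (N (z ↾ n)) ≺ q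
  μN↾-≺ z n {q} lt = μN-≺ (z ↾ n) (subst (_< q) (sym (½^-length-↾ z n)) lt)

  ¬μN↾-≺ : ∀ z n → ¬ (μ (N (z ↾ n)) ≺ ½ ^ n)
  ¬μN↾-≺ z n h = ¬μN-≺ (z ↾ n) (subst (μ (N (z ↾ n)) ≺_) (sym (½^-length-↾ z n)) h)

  -- Instead of summing over all strings of length `l`, follow a branch on which the density of the
  -- hole stays at least `q`. At length `l` that density is at most `½ ^ l`, a contradiction.
  μHole-≺ : ∀ l {q} → ½ ^ l < q → μ (Hole l) ≺ q
  μHole-≺ l {q} ½^l<q = decidable-stable em λ ¬h →
    let (z , low) = branch₀ (λ u → Low (Hole l) u q) (λ u → Low-split (Hole l) u q)
          (λ h → ¬h (subst (μ (Hole l) ≺_) (ℚ.*-identityʳ q) (μ-mono (λ x∈ → x∈ , refl) h)))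
    in  low l (density-↾ (Hole l) z l q (μ-mono
          (λ { {x} (hole , h) → Hole⇒N-fill l {x} {z} (N↾⇒≡ l h) hole })
          (μN↾-≺ (fill l z) (l ℕ.+ l)
            (subst (_< q * ½ ^ l) (sym (½^-homo-+ l l)) (ℚ.*-monoˡ-<-pos (½ ^ l) {{ ½^-pos l }} ½^l<q)))))

  -- The dense open sets.

  -- The point `y` ensures a marked string from which a path can start. An error below `2^-(3l+1)`
  -- has relative measure below `2^-(l+1)` even inside `N u` with `u` of length `2l`.
  Generic : ℕ → Pred MeasurableSet 0ℓ
  Generic n A = ∃[ l ] ∃[ b ] ∃[ y ] n ℕ.< l × b (y ↾ l) ≡ true × δ (patternSet l b) A ≺ ½ ^ suc (l ℕ.+ l ℕ.+ l)

  Generic-open : ∀ n → OpenIn (MALG em) (Generic n)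
  Generic-open n A (l , b , y , n<l , marked , near) =
    let (ε , ε< , near′) = rounded (δ (patternSet l b) A) near
    in  ½ ^ suc (l ℕ.+ l ℕ.+ l) - ε , p<q⇒0<q-p ε<
      , λ B close → l , b , y , n<l , marked
        , δ-triangle em (patternSet l b) A B (ε , _ , near′ , close
            , ℚ.≤-reflexive (solve 2 (λ x y → x :+ (y :- x) := y) refl ε (½ ^ suc (l ℕ.+ l ℕ.+ l))))
    where open +-*-Solver

  length-bound : ∀ (c : ℕ → List Bool) k → ∃[ m ] ∀ {i} → i ℕ.≤ k → length (c i) ℕ.≤ m
  length-bound c zero    = length (c 0) , λ { z≤n → ℕ.≤-refl }
  length-bound c (suc k) = let (m , le) = length-bound c k in
    m ℕ.⊔ length (c (suc k)) , λ i≤ → case ℕ.m≤n⇒m<n∨m≡n i≤ of λ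
      { (inj₁ (s≤s i≤k)) → ℕ.≤-trans (le i≤k) (ℕ.m≤m⊔n m _)
      ; (inj₂ refl)      → ℕ.m≤n⊔m m _ }

  Upto-determined : ∀ c k l → (∀ {i} → i ℕ.≤ k → length (c i) ℕ.≤ l) → Determined l (Upto c k)
  Upto-determined c k l le eq (i , i≤k , h) = i , i≤k , trans (sym (↾-mono (le i≤k) eq)) h

  Generic-dense : ∀ n → DenseIn (MALG em) (Generic n)
  Generic-dense n A ε 0<ε = approx (clopen-approximation A (0<½* 0<ε))
    where
    approx : ∃[ c ] ∃[ k ] μ (set A △ Upto c k) ≺ ½ * ε → ∃[ B ] δ A B ≺ ε × B ∈ Generic n
    approx (c , k , close) =
        patternSet l b
      , μ-⊆∪ {Y = set A △ Upto c k} {Hole l} {½ * ε} {½ * ε} {ε} incl close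
          (μHole-≺ l (ℚ.≤-<-trans (½^-anti-≤ j≤l) (proj₂ tiny½ε)))
          (ℚ.≤-reflexive (½*+½* ε))
      -- `Upto c k` always contains `N (c 0)`, so some string is marked even if `A` is null.
      , l , b , y , ℕ.m≤m⊔n (suc n) (j ℕ.⊔ m) , dec-true em (y , refl , 0 , z≤n , proj₂ (N-inhabited (c 0)))
      , μ-mono (λ { (inj₁ (a , ¬a)) → contradiction a ¬a ; (inj₂ (a , ¬a)) → contradiction a ¬a })
          (proj₂ (empty⇒null {λ _ → ⊥} (λ _ ())) (0<½^ (suc (l ℕ.+ l ℕ.+ l))))
      where
      tiny½ε = ½^-small (½ * ε) (0<½* 0<ε)
      m = proj₁ (length-bound c k)
      j = proj₁ tiny½ε
      l = suc n ℕ.⊔ (j ℕ.⊔ m)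
      j≤l : j ℕ.≤ l
      j≤l = ℕ.≤-trans (ℕ.m≤m⊔n j m) (ℕ.m≤n⊔m (suc n) (j ℕ.⊔ m))
      m≤l : m ℕ.≤ l
      m≤l = ℕ.≤-trans (ℕ.m≤n⊔m j m) (ℕ.m≤n⊔m (suc n) (j ℕ.⊔ m))
      y = proj₁ (N-inhabited (c 0))
      b : List Bool → Bool
      b s = truth (∃[ x ] x ↾ l ≡ s × Upto c k x)
      det : Determined l (Upto c k)
      det = Upto-determined c k l λ i≤k → ℕ.≤-trans (proj₂ (length-bound c k) i≤k)
              m≤l
      incl : set A △ Pattern l b ⊆ (set A △ Upto c k) ∪ Hole l
      incl {x} (inj₁ (x∈A , x∉P)) = case em {Upto c k x} of λ
        { (yes x∈U) → inj₂ (unpatterned⇒Hole {b = b} {x} (dec-true em (x , refl , x∈U)) x∉P)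
        ; (no x∉U)  → inj₁ (inj₁ (x∈A , x∉U)) }
      incl {x} (inj₂ ((marked , _) , x∉A)) =
        let (y , eq , y∈U) = truth⇒ marked in inj₁ (inj₂ (det {y} {x} eq y∈U , x∉A))

  -- Greedy moves and densities near a pattern.

  -- All lower bounds `q` are compared at once, so that one bit serves every `q`: go left if the
  -- left half is at least as dense as `u`.
  greedy : Pred Cantor 0ℓ → List Bool → Bool
  greedy A u = not (truth (∀ q → Low A u q → Low A (u ∷ʳ false) q))

  -- If the move is to the right, some `p` bounds the density at `u` but not on the left. Splitting
  -- at the larger of `p` and `q` rules out the left half, which leaves the right one.
  Low-greedy : ∀ A u q → Low A u q → Low A (u ∷ʳ greedy A u) q
  Low-greedy A u q low with em {∀ q → Low A u q → Low A (u ∷ʳ false) q}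
  ... | yes keep = keep q low
  ... | no ¬keep with ¬∀⇒∃¬ ¬keep
  ... | p , ¬keep-p with ℚ.≤-total p q
  ... | inj₁ p≤q = case Low-split A u q low of λ
        { (inj₁ low₀) → contradiction (λ _ → Low-antitone A (u ∷ʳ false) p≤q low₀) ¬keep-p
        ; (inj₂ low₁) → low₁ }
  ... | inj₂ q≤p = decidable-stable em λ ¬low₁ → ¬keep-p λ low-p → case Low-split A u p low-p of λ
        { (inj₁ low₀) → low₀
        ; (inj₂ low₁) → contradiction (Low-antitone A (u ∷ʳ true) q≤p low₁) ¬low₁ }

  Low-cover : ∀ {A Z} z n t → N (z ↾ n) ⊆ A ∪ Z → μ Z ≺ t * ½ ^ n → Low A (z ↾ n) (1ℚ - t)
  Low-cover {A} {Z} z n t incl Z≺ low = ¬μN↾-≺ z n (μ-⊆∪ {Y = A ∩ N (z ↾ n)} {Z}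
    (λ h → case incl h of λ { (inj₁ x∈A) → inj₁ (x∈A , h) ; (inj₂ x∈Z) → inj₂ x∈Z })
    (density-↾⁻¹ A z n (1ℚ - t) low) Z≺
    (ℚ.≤-reflexive (trans (sym (ℚ.*-distribʳ-+ (½ ^ n) (1ℚ - t) t))
      (trans (cong (_* ½ ^ n) (solve 2 (λ x y → x :- y :+ y := x) refl 1ℚ t)) (ℚ.*-identityˡ (½ ^ n))))))
    where open +-*-Solver

  module _ (A : Pred Cantor 0ℓ) (l : ℕ) (b : List Bool → Bool)
           (near : μ (Pattern l b △ A) ≺ ½ ^ suc (l ℕ.+ l ℕ.+ l)) where

    ≺-near : ∀ {q} → ½ ^ suc (l ℕ.+ l ℕ.+ l) ≤ q → μ (Pattern l b △ A) ≺ q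
    ≺-near le = upper (μ (Pattern l b △ A)) le near

    -- Inside an unmarked neighbourhood all of `A` belongs to the error, which fills less than half
    -- of it.
    Low⇒marked : ∀ z → Low A (z ↾ l) ½ → b (z ↾ l) ≡ true
    Low⇒marked z low with b (z ↾ l) in eq
    ... | true  = refl
    ... | false = contradiction (density-↾ A z l ½ (μ-mono
            (λ { {x} (x∈A , h) → inj₂ (x∈A , λ (marked , _) →
              case trans (sym marked) (trans (cong b (N↾⇒≡ {x} {z} l h)) eq) of λ ()) })
            (≺-near (½^-anti-≤ (s≤s (ℕ.m≤n+m l (l ℕ.+ l))))))) low

    module _ (z : Cantor) (n : ℕ) (l≤n : l ℕ.≤ n) where

      private
        prefix : ∀ {x} → N (z ↾ n) x → x ↾ l ≡ z ↾ l
        prefix {x} h = ↾-mono l≤n (N↾⇒≡ {x} {z} n h)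

      -- In a marked neighbourhood `A` can miss only the hole and the error. The hole takes at most
      -- half of the allowance `½ ^ r * ½ ^ n`, and the error less than the other half.
      Low-dip : b (z ↾ l) ≡ true → ∀ r → n ℕ.+ suc r ℕ.≤ l ℕ.+ l → Low A (z ↾ n) (1ℚ - ½ ^ r)
      Low-dip marked r le = Low-cover {A} {(Pattern l b △ A) ∪ N (fill l z ↾ (l ℕ.+ l))} z n (½ ^ r) incl
        (μ-⊆∪ {Y = Pattern l b △ A} {N (fill l z ↾ (l ℕ.+ l))} {e} {w - e} {w}
          (λ h → h) near (μN↾-≺ (fill l z) (l ℕ.+ l) gap)
          (ℚ.≤-reflexive (solve 2 (λ x y → x :+ (y :- x) := y) refl (e) w)))
        where
        open +-*-Solver
        e = ½ ^ suc (l ℕ.+ l ℕ.+ l)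
        w = ½ ^ r * ½ ^ n
        incl : N (z ↾ n) ⊆ A ∪ ((Pattern l b △ A) ∪ N (fill l z ↾ (l ℕ.+ l)))
        incl {x} h with em {A x} | em {Pattern l b x}
        ... | yes x∈A | _     = inj₁ x∈A
        ... | no x∉A  | yes p = inj₂ (inj₁ (inj₁ (p , x∉A)))
        ... | no x∉A  | no ¬p = inj₂ (inj₂ (Hole⇒N-fill l (prefix {x} h)
          (unpatterned⇒Hole {b = b} {x} (trans (cong b (prefix {x} h)) marked) ¬p)))
        1+r+n≤2l : suc (r ℕ.+ n) ℕ.≤ l ℕ.+ l
        1+r+n≤2l = subst (ℕ._≤ l ℕ.+ l) (trans (ℕ.+-suc n r) (cong suc (ℕ.+-comm n r))) le
        e< : e < ½ ^ suc (r ℕ.+ n)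
        e< = ½^-anti-< (s≤s (ℕ.≤-trans 1+r+n≤2l (ℕ.m≤m+n (l ℕ.+ l) l)))
        gap : ½ ^ (l ℕ.+ l) < w - e
        gap = begin-strict
          ½ ^ (l ℕ.+ l)                           ≤⟨ ½^-anti-≤ 1+r+n≤2l ⟩
          v                                       ≡⟨ solve 1 (λ x → x := x :+ x :- x) refl v ⟩
          v + v - v                               <⟨ ℚ.+-monoʳ-< (v + v) (ℚ.neg-antimono-< e<) ⟩
          v + v - e         ≡⟨ cong (_- e) (trans (half (r ℕ.+ n)) (½^-homo-+ r n)) ⟩
          w - e             ∎
          where
          open ℚ.≤-Reasoning
          v = ½ ^ suc (r ℕ.+ n)

      -- Along zeros the whole hole stays inside `N (z ↾ n)`, of which it fills `½ ^ (1 + r)`. Half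
      -- of the hole is given up to the error and to strictness, whence the exponent `2 + r`.
      dip : ∀ r → n ℕ.+ suc r ≡ l ℕ.+ l → (∀ {i} → l ℕ.≤ i → i ℕ.< n → z i ≡ false) →
            density A (z ↾ n) ≺ 1ℚ - ½ ^ (2 ℕ.+ r)
      dip r eq zeros = density-↾ A z n (1ℚ - ½ ^ (2 ℕ.+ r)) (carve
        (proj₁ (determined⇒measurable (l ℕ.+ l) hole-determined (N (z ↾ n))) (μN↾-≺ z n {½ ^ n + (d - e)}
          (gap-< (d - e) (p<q⇒0<q-p (½^-anti-< (s≤s 2l<3l))) refl))))
        where
        open +-*-Solver
        h = fill l z
        e = ½ ^ suc (l ℕ.+ l ℕ.+ l)
        d = ½ ^ suc (l ℕ.+ l)
        t = ½ ^ (2 ℕ.+ r)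
        d≡ : d ≡ t * ½ ^ n
        d≡ = trans (cong (λ m → ½ ^ suc m) (trans (sym eq) (ℕ.+-comm n (suc r)))) (½^-homo-+ (2 ℕ.+ r) n)
        n<2l : n ℕ.< l ℕ.+ l
        n<2l = subst (n ℕ.<_) eq (subst (n ℕ.<_) (sym (ℕ.+-suc n r)) (s≤s (ℕ.m≤m+n n r)))
        2l<3l : l ℕ.+ l ℕ.< l ℕ.+ l ℕ.+ l
        2l<3l = ℕ.m<m+n (l ℕ.+ l) 
          (ℕ.+-cancelˡ-< l 0 l (subst (ℕ._< l ℕ.+ l) (sym (ℕ.+-identityʳ l)) (ℕ.≤-<-trans l≤n n<2l)))
        hole-determined : Determined (l ℕ.+ l) (N (h ↾ (l ℕ.+ l)))
        hole-determined {x} {y} x≡y hx = ≡⇒N↾ (l ℕ.+ l) (trans (sym x≡y) (N↾⇒≡ {x} {h} (l ℕ.+ l) hx))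
        h≡z : ∀ {i} → i ℕ.< n → h i ≡ z i
        h≡z {i} i<n with i ℕ.<? l
        ... | yes i<l = fill-< l z i<l
        ... | no i≮l  = trans (fill-≥ l z (ℕ.≮⇒≥ i≮l)) (sym (zeros (ℕ.≮⇒≥ i≮l) i<n))
        hole⊆ : N (h ↾ (l ℕ.+ l)) ⊆ N (z ↾ n) ∩ N (h ↾ (l ℕ.+ l))
        hole⊆ {x} hx = ≡⇒N↾ n (trans (↾-mono (ℕ.<⇒≤ n<2l) (N↾⇒≡ {x} {h} (l ℕ.+ l) hx)) (bits-↾ n h≡z)) , hx
        incl : A ∩ N (z ↾ n) ⊆ (Pattern l b △ A) ∪ (N (z ↾ n) ∖ N (h ↾ (l ℕ.+ l)))
        incl {x} (x∈A , hz) with em {Pattern l b x}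
        ... | no ¬p = inj₁ (inj₂ (x∈A , ¬p))
        ... | yes (_ , k , k<l , one) = inj₂ (hz , λ hx → case trans (sym one)
              (trans (↾-bits (l ℕ.+ l) (N↾⇒≡ {x} {h} (l ℕ.+ l) hx) (ℕ.+-monoʳ-< l k<l))
                     (fill-≥ l z (ℕ.m≤m+n l k))) of λ ())
        carve : (μ (N (z ↾ n) ∩ N (h ↾ (l ℕ.+ l))) ⊕ μ (N (z ↾ n) ∖ N (h ↾ (l ℕ.+ l)))) ≺ ½ ^ n + (d - e) →
                μ (A ∩ N (z ↾ n)) ≺ (1ℚ - ½ ^ (2 ℕ.+ r)) * ½ ^ n
        carve (a , c , ≺a , ≺c , a+c≤) =
          μ-⊆∪ {Y = Pattern l b △ A} {N (z ↾ n) ∖ N (h ↾ (l ℕ.+ l))} {e} {c} incl near ≺c bound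
          where
          -- The hole has measure `2d`, where `d` is half of it; hence `a` exceeds `2d` and `c`
          -- stays below `½ ^ n - d - e`.
          2l<a : ½ ^ (l ℕ.+ l) < a
          2l<a = ℚ.≰⇒> λ a≤ → ¬μN↾-≺ h (l ℕ.+ l) (upper (μ (N (h ↾ (l ℕ.+ l)))) a≤ (μ-mono hole⊆ ≺a))
          bound : e + c ≤ (1ℚ - t) * ½ ^ n
          bound = begin
            e + c
              ≡⟨ solve 3 (λ e a c → e :+ c := e :+ (a :+ c :- a)) refl e a c ⟩
            e + (a + c - a)
              ≤⟨ ℚ.+-monoʳ-≤ e (ℚ.+-mono-≤ a+c≤ (ℚ.neg-antimono-≤ (ℚ.<⇒≤ 2l<a))) ⟩
            e + (½ ^ n + (d - e) - ½ ^ (l ℕ.+ l))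
              ≡⟨ cong (λ v → e + (½ ^ n + (d - e) - v)) (sym (half (l ℕ.+ l))) ⟩
            e + (½ ^ n + (d - e) - (d + d))
              ≡⟨ solve 3 (λ e p d → e :+ (p :+ (d :- e) :- (d :+ d)) := p :- d) refl e (½ ^ n) d ⟩
            ½ ^ n - d
              ≡⟨ cong (λ v → ½ ^ n - v) d≡ ⟩
            ½ ^ n - t * ½ ^ n
              ≡⟨ cong (_- t * ½ ^ n) (sym (ℚ.*-identityˡ (½ ^ n))) ⟩
            1ℚ * ½ ^ n - t * ½ ^ n
              ≡⟨ solve 3 (λ o t p → o :* p :- t :* p := (o :- t) :* p) refl 1ℚ t (½ ^ n) ⟩
            (1ℚ - t) * ½ ^ n ∎
            where open ℚ.≤-Reasoning

      -- A bit 1 among the positions from `l` to `2l - 1` avoids the hole, so that `N (z ↾ n)` lies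
      -- in the pattern and only the error is missing.
      Low-after-dip : b (z ↾ l) ≡ true → n ℕ.≤ l ℕ.+ l → ∀ {k} → k ℕ.< l → l ℕ.+ k ℕ.< n → z (l ℕ.+ k) ≡ true →
                      Low A (z ↾ n) (1ℚ - ½ ^ l)
      Low-after-dip marked n≤2l {k} k<l l+k<n one = Low-cover {A} {Pattern l b △ A} z n (½ ^ l) incl
        (subst (μ (Pattern l b △ A) ≺_) (½^-homo-+ l n) (≺-near (½^-anti-≤ (ℕ.m≤n⇒m≤1+n
          (ℕ.≤-trans (ℕ.+-monoʳ-≤ l n≤2l) (ℕ.≤-reflexive (sym (ℕ.+-assoc l l l))))))))
        where
        incl : N (z ↾ n) ⊆ A ∪ (Pattern l b △ A)
        incl {x} h = case em {A x} of λ
          { (yes x∈A) → inj₁ x∈A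
          ; (no x∉A)  → inj₂ (inj₁ ((trans (cong b (prefix {x} h)) marked , k , k<l
                          , trans (↾-bits n (N↾⇒≡ {x} {z} n h) l+k<n) one) , x∉A)) }

  -- The upper bound on the complexity of `Φ A`.

  -- The condition at each `n` depends only on `x ↾ n`, so demanding it for all `n` from `k` on is
  -- closed; the tolerances `½ ^ m` suffice.
  Φ-Fσδ : ∀ A → Fσδ (Φ A)
  Φ-Fσδ A = C , closed , to , from
    where
    Near : ℚ → List Bool → Set
    Near ε u = density A u ≺ 1ℚ + ε × ¬ (density A u ≺ 1ℚ - ε)
    C : ℕ → ℕ → Pred Cantor 0ℓ
    C m k x = ∀ n → k ℕ.≤ n → Near (½ ^ m) (x ↾ n)
    closed : ∀ m k → Closed (C m k)
    closed m k x x∉C =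
      let (n , ¬near) = ¬∀⇒∃¬ x∉C
      in  n , λ {y} h y∈C → ¬near λ k≤n → subst (Near (½ ^ m)) (N↾⇒≡ {y} {x} n h) (y∈C n k≤n)
    to : Φ A ⊆ ⋂ ℕ (λ m → ⋃ ℕ (C m))
    to x∈Φ m = x∈Φ (½ ^ m) (0<½^ m)
    from : ⋂ ℕ (λ m → ⋃ ℕ (C m)) ⊆ Φ A
    from {x} x∈ ε 0<ε =
      let (m , ½^m<ε) = ½^-small ε 0<ε
          (k , near) = x∈ m
      in  k , λ n k≤n → upper (density A (x ↾ n)) (ℚ.+-monoʳ-≤ 1ℚ (ℚ.<⇒≤ ½^m<ε)) (proj₁ (near n k≤n))
                      , Low-antitone A (x ↾ n) (ℚ.+-monoʳ-≤ 1ℚ (ℚ.neg-antimono-≤ (ℚ.<⇒≤ ½^m<ε))) (proj₂ (near n k≤n))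

  -- Paths through a generic set, steered by ranks.

  module _ (A : MeasurableSet) (gen : A ∈ ⋂ ℕ Generic) where

    -- Each level exceeds twice the previous one, so the positions carrying the hole of one pattern
    -- end before the next pattern begins.
    index level : ℕ → ℕ
    index zero    = 0
    index (suc j) = level j ℕ.+ level j
    level j = proj₁ (gen (index j))

    marking : ℕ → List Bool → Bool
    marking j = proj₁ (proj₂ (gen (index j)))

    start : Cantor
    start = proj₁ (proj₂ (proj₂ (gen 0)))

    index<level : ∀ j → index j ℕ.< level j
    index<level j = proj₁ (proj₂ (proj₂ (proj₂ (gen (index j)))))

    near-pattern : ∀ j → δ (patternSet (level j) (marking j)) A ≺ ½ ^ suc (level j ℕ.+ level j ℕ.+ level j)
    near-pattern j = proj₂ (proj₂ (proj₂ (proj₂ (proj₂ (gen (index j))))))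

    j<level : ∀ j → j ℕ.< level j
    j<level zero    = index<level 0
    j<level (suc j) = ℕ.≤-<-trans (j<level j) (ℕ.≤-<-trans (ℕ.m≤m+n (level j) (level j)) (index<level (suc j)))

    level-mono : ∀ {i j} → i ℕ.≤ j → level i ℕ.≤ level j
    level-mono {i} {j} i≤j with ℕ.m≤n⇒m<n∨m≡n i≤j
    ... | inj₂ refl = ℕ.≤-refl
    level-mono {i} {suc j} _ | inj₁ (s≤s i≤j) =
      ℕ.≤-trans (level-mono i≤j) (ℕ.≤-trans (ℕ.m≤m+n (level j) (level j)) (ℕ.<⇒≤ (index<level (suc j))))

    stage-unique : ∀ {i j n} → level i ℕ.≤ n → n ℕ.< level (suc i) → level j ℕ.≤ n → n ℕ.< level (suc j) → i ≡ j
    stage-unique {i} {j} i≤ i< j≤ j< with ℕ.<-cmp i j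
    ... | tri≈ _ i≡j _ = i≡j
    ... | tri< i<j _ _ = contradiction (ℕ.<-≤-trans i< (ℕ.≤-trans (level-mono i<j) j≤)) (ℕ.<-irrefl refl)
    ... | tri> _ _ j<i = contradiction (ℕ.<-≤-trans j< (ℕ.≤-trans (level-mono j<i) i≤)) (ℕ.<-irrefl refl)

    stage : ∀ J d n → level J ℕ.≤ n → n ℕ.< level (J ℕ.+ d) → ∃[ j ] J ℕ.≤ j × level j ℕ.≤ n × n ℕ.< level (suc j)
    stage J zero    n J≤ n< =
      contradiction (ℕ.<-≤-trans (subst (λ i → n ℕ.< level i) (ℕ.+-identityʳ J) n<) J≤) (ℕ.<-irrefl refl)
    stage J (suc d) n J≤ n< with level (J ℕ.+ d) ℕ.≤? n
    ... | yes le = J ℕ.+ d , ℕ.m≤m+n J d , le , subst (λ i → n ℕ.< level i) (ℕ.+-suc J d) n<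
    ... | no ≰n  = stage J d n J≤ (ℕ.≰⇒> ≰n)

    -- The rank r j prescribes how close to the hole at level j the point
    -- passes: it falls along zeros until the hole occupies the fraction
    -- 2^-(r j + 1) of the neighbourhood, and then turns away.
    Falling Turning : (ℕ → ℕ) → ℕ → Set
    Falling r n = ∃[ j ] level j ℕ.≤ n × n ℕ.+ suc (r j) ℕ.< level j ℕ.+ level j
    Turning r n = ∃[ j ] level j ℕ.≤ n × n ℕ.+ suc (r j) ≡ level j ℕ.+ level j

    rule : (ℕ → ℕ) → List Bool → Bool
    rule r u =
      if does (length u ℕ.<? level 0) then start (length u) else
      if truth (Falling r (length u)) then false else
      if truth (Turning r (length u)) then true else
      greedy (set A) u

    -- Only ranks `r j` with `level j` at most the length of `u` are consulted, and `j` is less than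
    -- `level j`.
    rule-cong : ∀ {r r′} n → (∀ j → j ℕ.< n → r j ≡ r′ j) → ∀ u → length u ℕ.< n → rule r u ≡ rule r′ u
    rule-cong {r} {r′} n eq u u<n = cong₂ (λ p q → if does (length u ℕ.<? level 0) then start (length u) else
      (if p then false else (if q then true else greedy (set A) u)))
      (truth-cong (λ (j , le , lt) → j , le , subst (λ k → length u ℕ.+ suc k ℕ.< level j ℕ.+ level j) (at j le) lt)
                  (λ (j , le , lt) → j , le , subst (λ k → length u ℕ.+ suc k ℕ.< level j ℕ.+ level j) (sym (at j le)) lt))
      (truth-cong (λ (j , le , e) → j , le , subst (λ k → length u ℕ.+ suc k ≡ level j ℕ.+ level j) (at j le) e)
                  (λ (j , le , e) → j , le , subst (λ k → length u ℕ.+ suc k ≡ level j ℕ.+ level j) (sym (at j le)) e))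
      where
      at : ∀ j → level j ℕ.≤ length u → r j ≡ r′ j
      at j le = eq j (ℕ.<-trans (ℕ.<-≤-trans (j<level j) le) u<n)

    module _ (r : ℕ → ℕ) (r≤ : ∀ j → r j ℕ.≤ j) where

      private
        z : Cantor
        z = run (rule r)

        r<level : ∀ j → r j ℕ.< level j
        r<level j = ℕ.≤-<-trans (r≤ j) (j<level j)

        below : ∀ j {n} → n ℕ.+ suc (r j) ℕ.≤ level j ℕ.+ level j → n ℕ.< level (suc j)
        below j {n} le = ℕ.<-trans (ℕ.<-≤-trans (ℕ.m<m+n n (s≤s z≤n)) le) (index<level (suc j))

        z-rule : ∀ n → z n ≡ (if does (n ℕ.<? level 0) then start n else
                              if truth (Falling r n) then false else
                              if truth (Turning r n) then true else greedy (set A) (z ↾ n))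
        z-rule n = trans (run-step (rule r) n) (cong (λ m → if does (m ℕ.<? level 0) then start m else
          if truth (Falling r m) then false else if truth (Turning r m) then true else greedy (set A) (z ↾ n))
          (length-applyUpTo z n))

        -- The three tests become variables, so that each can be replaced by its known value and
        -- later tests left as they are.
        branches : Bool → Bool → Bool → ℕ → Bool
        branches p q s n = if p then start n else if q then false else if s then true else greedy (set A) (z ↾ n)

        z-branches : ∀ n {p q s} → does (n ℕ.<? level 0) ≡ p → truth (Falling r n) ≡ q → truth (Turning r n) ≡ s →
                     z n ≡ branches p q s n
        z-branches n refl refl refl = z-rule n

        started : ∀ j {n} → level j ℕ.≤ n → does (n ℕ.<? level 0) ≡ false
        started j {n} le = dec-false (n ℕ.<? level 0) (ℕ.≤⇒≯ (ℕ.≤-trans (level-mono {0} {j} z≤n) le))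

        z-start : ∀ {n} → n ℕ.< level 0 → z n ≡ start n
        z-start {n} lt = z-branches n (dec-true (n ℕ.<? level 0) lt) refl refl

        z-fall : ∀ j {n} → level j ℕ.≤ n → n ℕ.+ suc (r j) ℕ.< level j ℕ.+ level j → z n ≡ false
        z-fall j {n} le lt = z-branches n (started j le) (dec-true em (j , le , lt)) refl

        z-turn : ∀ j {n} → level j ℕ.≤ n → n ℕ.+ suc (r j) ≡ level j ℕ.+ level j → z n ≡ true
        z-turn j {n} le eq = z-branches n (started j le) (dec-false em ¬falling) (dec-true em (j , le , eq))
          where
          ¬falling : ¬ Falling r n
          ¬falling (i , le′ , lt) with stage-unique {i} {j} le′ (below i (ℕ.<⇒≤ lt)) le (below j (ℕ.≤-reflexive eq))
          ... | refl = ℕ.<-irrefl eq lt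

        z-greedy : ∀ j {n} → level j ℕ.≤ n → n ℕ.< level (suc j) → level j ℕ.+ level j ℕ.< n ℕ.+ suc (r j) →
                   z n ≡ greedy (set A) (z ↾ n)
        z-greedy j {n} le lt past = z-branches n (started j le)
          (dec-false em λ (i , le′ , lt′) → ¬dipping i le′ (ℕ.<⇒≤ lt′))
          (dec-false em λ (i , le′ , eq) → ¬dipping i le′ (ℕ.≤-reflexive eq))
          where
          ¬dipping : ∀ i → level i ℕ.≤ n → ¬ (n ℕ.+ suc (r i) ℕ.≤ level i ℕ.+ level i)
          ¬dipping i le′ ≤2l with stage-unique {i} {j} le′ (below i ≤2l) le lt
          ... | refl = ℕ.<⇒≱ past ≤2l

        turn : ℕ → ℕ
        turn j = level j ℕ.+ (level j ℕ.∸ suc (r j))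

        turn-+ : ∀ j → turn j ℕ.+ suc (r j) ≡ level j ℕ.+ level j
        turn-+ j = trans (ℕ.+-assoc (level j) _ (suc (r j))) (cong (level j ℕ.+_) (ℕ.m∸n+n≡m (r<level j)))

        turn< : ∀ j → level j ℕ.∸ suc (r j) ℕ.< level j
        turn< j = ℕ.∸-monoʳ-< {level j} {suc (r j)} {0} (s≤s z≤n) (r<level j)

        -- Induction from the position just after the turn: there the hole has been avoided, and
        -- greedy moves keep the bound up to the next level.
        after : ∀ j → marking j (z ↾ level j) ≡ true → ∀ n → n ℕ.≤ level (suc j) →
                level j ℕ.+ level j ℕ.< n ℕ.+ suc (r j) → Low (set A) (z ↾ n) (1ℚ - ½ ^ level j)
        after j marked zero    _  past = contradiction past
          (ℕ.≤⇒≯ (ℕ.≤-trans (r<level j) (ℕ.m≤m+n (level j) (level j))))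
        after j marked (suc n) n≤ past with ℕ.m≤n⇒m<n∨m≡n (ℕ.≤-pred past)
        ... | inj₁ past′ = subst (λ u → Low (set A) u (1ℚ - ½ ^ level j))
              (trans (cong (z ↾ n ∷ʳ_) (sym (z-greedy j level≤n n≤ past′))) (applyUpTo-∷ʳ z n))
              (Low-greedy (set A) (z ↾ n) (1ℚ - ½ ^ level j) (after j marked n (ℕ.<⇒≤ n≤) past′))
          where
          level≤n : level j ℕ.≤ n
          level≤n = ℕ.+-cancelʳ-≤ (level j) (level j) n
            (ℕ.≤-trans (ℕ.<⇒≤ past′) (ℕ.+-monoʳ-≤ n (r<level j)))
        -- The base case, in which `n` is the position of the turn itself.
        ... | inj₂ eq = subst (λ m → Low (set A) (z ↾ suc m) (1ℚ - ½ ^ level j)) turn≡n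
              (Low-after-dip (set A) (level j) (marking j) (near-pattern j) z (suc (turn j))
                (ℕ.m≤n⇒m≤1+n (ℕ.m≤m+n (level j) _)) marked (ℕ.+-monoʳ-< (level j) (turn< j)) (turn< j) ℕ.≤-refl
                (z-turn j (ℕ.m≤m+n (level j) _) (turn-+ j)))
          where
          turn≡n : turn j ≡ n
          turn≡n = ℕ.+-cancelʳ-≡ (suc (r j)) (turn j) n (trans (turn-+ j) eq)

        1-½^-mono : ∀ {m n} → m ℕ.≤ n → 1ℚ - ½ ^ m ≤ 1ℚ - ½ ^ n
        1-½^-mono m≤n = ℚ.+-monoʳ-≤ 1ℚ (ℚ.neg-antimono-≤ (½^-anti-≤ m≤n))

        -- The path starts along a marked string. Later it reaches each level with density at least
        -- `½`, which unmarked neighbourhoods do not have.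
        marked : ∀ j → marking j (z ↾ level j) ≡ true
        marked zero    = trans (cong (marking 0) (bits-↾ (level 0) z-start))
                               (proj₁ (proj₂ (proj₂ (proj₂ (proj₂ (gen 0))))))
        marked (suc j) = Low⇒marked (set A) (level (suc j)) (marking (suc j)) (near-pattern (suc j)) z
          (Low-antitone (set A) (z ↾ level (suc j)) (1-½^-mono {1} (ℕ.≤-trans (s≤s z≤n) (j<level j)))
            (after j (marked j) (level (suc j)) ℕ.≤-refl
              (ℕ.<-≤-trans (index<level (suc j)) (ℕ.m≤m+n (level (suc j)) _))))

        -- Up to the turn the hole is the main loss; after it the stronger bound of `after` applies,
        -- since `r j` is less than `level j`.
        Low-rank : ∀ j n → level j ℕ.≤ n → n ℕ.< level (suc j) → Low (set A) (z ↾ n) (1ℚ - ½ ^ r j)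
        Low-rank j n le lt with n ℕ.+ suc (r j) ℕ.≤? level j ℕ.+ level j
        ... | yes ≤2l = Low-dip (set A) (level j) (marking j) (near-pattern j) z n le (marked j) (r j) ≤2l
        ... | no ≰2l  = Low-antitone (set A) (z ↾ n) (1-½^-mono (ℕ.<⇒≤ (r<level j)))
                          (after j (marked j) n (ℕ.<⇒≤ lt) (ℕ.≰⇒> ≰2l))

        dip-rank : ∀ j → density (set A) (z ↾ turn j) ≺ 1ℚ - ½ ^ (2 ℕ.+ r j)
        dip-rank j = dip (set A) (level j) (marking j) (near-pattern j) z (turn j)
          (ℕ.m≤m+n (level j) _) (r j) (turn-+ j)
          (λ {i} le lt → z-fall j le (ℕ.<-≤-trans (ℕ.+-monoˡ-< (suc (r j)) lt) (ℕ.≤-reflexive (turn-+ j))))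

      rank→∞⇒∈Φ : (∀ R → ∃[ J ] ∀ j → J ℕ.≤ j → R ℕ.≤ r j) → z ∈ Φ (set A)
      rank→∞⇒∈Φ r→∞ ε 0<ε =
        let (R , ½^R<ε) = ½^-small ε 0<ε
            (J , R≤r) = r→∞ R
        in  level J , λ n J≤n →
          -- The search for the stage can be bounded by `n`, since `n` is less than `level (J + n)`.
          let (j , J≤j , le , lt) = stage J n n J≤n
                (ℕ.≤-<-trans (ℕ.m≤n+m n J) (j<level (J ℕ.+ n)))
          in  density-↾ (set A) z n (1ℚ + ε) (μ-mono {B = N (z ↾ n)} proj₂ (μN↾-≺ z n
                (subst (_< (1ℚ + ε) * ½ ^ n) (ℚ.*-identityˡ (½ ^ n))
                  (ℚ.*-monoˡ-<-pos (½ ^ n) {{ ½^-pos n }} (gap-< {1ℚ} {1ℚ + ε} ε 0<ε refl)))))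
            , Low-antitone (set A) (z ↾ n)
                (ℚ.+-monoʳ-≤ 1ℚ (ℚ.neg-antimono-≤ (ℚ.≤-trans (½^-anti-≤ (R≤r j J≤j)) (ℚ.<⇒≤ ½^R<ε))))
                (Low-rank j n le lt)

      rank-recurs⇒∉Φ : ∀ m → (∀ J → ∃[ j ] J ℕ.≤ j × r j ℕ.≤ m) → ¬ z ∈ Φ (set A)
      rank-recurs⇒∉Φ m recurs z∈Φ =
        -- A dip of rank at most `m` goes below `1ℚ - ½ ^ (2 + m)`, so this tolerance is violated
        -- again and again.
        let (k , lim) = z∈Φ (½ ^ (2 ℕ.+ m)) (0<½^ (2 ℕ.+ m))
            (j , k≤j , r≤m) = recurs k
        in  proj₂ (lim (turn j) (ℕ.≤-trans k≤j (ℕ.≤-trans (ℕ.<⇒≤ (j<level j)) (ℕ.m≤m+n (level j) _))))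
              (upper (density (set A) (z ↾ turn j)) (1-½^-mono (s≤s (s≤s r≤m))) (dip-rank j))

  -- Ranks of a point relative to an intersection of countable unions of closed sets.

  -- A bounded search for the least hit. The default `j` lets the ranks grow when the hits move off
  -- to infinity.
  first : (ℕ → Bool) → ℕ → ℕ
  first P zero    = 0
  first P (suc j) = if P 0 then 0 else suc (first (P ∘ suc) j)

  first-≤ : ∀ P j → first P j ℕ.≤ j
  first-≤ P zero    = z≤n
  first-≤ P (suc j) with P 0
  ... | true  = z≤n
  ... | false = s≤s (first-≤ (P ∘ suc) j)

  first-hit : ∀ P j {m} → P m ≡ true → first P j ℕ.≤ m
  first-hit P zero    hit = z≤n
  first-hit P (suc j) {m} hit with P 0 in eq
  ... | true = z≤n
  first-hit P (suc j) {zero}  hit | false = contradiction (trans (sym eq) hit) λ ()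
  first-hit P (suc j) {suc m} hit | false = s≤s (first-hit (P ∘ suc) j hit)

  first-avoid : ∀ P j {R} → R ℕ.≤ j → (∀ m → m ℕ.< R → P m ≡ false) → R ℕ.≤ first P j
  first-avoid P j       {zero}  _         _     = z≤n
  first-avoid P (suc j) {suc R} (s≤s R≤j) avoid with P 0 | avoid 0 (s≤s z≤n)
  ... | false | _ = s≤s (first-avoid (P ∘ suc) j R≤j (λ m m<R → avoid (suc m) (s≤s m<R)))

  first-cong : ∀ {P Q} j → (∀ m → P m ≡ Q m) → first P j ≡ first Q j
  first-cong zero    P≗Q = refl
  first-cong (suc j) P≗Q = cong₂ (λ b n → if b then 0 else suc n) (P≗Q 0) (first-cong j (P≗Q ∘ suc))

  module _ (C : ℕ → ℕ → Pred Cantor 0ℓ) (closed : ∀ m k → Closed (C m k)) where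

    Alive : ℕ → ℕ → List Bool → Set
    Alive m k u = ∃[ y ] N u y × C m k y

    -- The m-th pointer is the current guess of a k with x ∈ C m k; it moves on,
    -- and m signals, when the guess is refuted by the bits of x read so far.
    pointer : Cantor → ℕ → ℕ → ℕ
    signal  : Cantor → ℕ → ℕ → Bool
    pointer x m zero    = 0
    pointer x m (suc j) = if signal x m j then suc (pointer x m j) else pointer x m j
    signal x m j = not (truth (Alive m (pointer x m j) (x ↾ j)))

    rank : Cantor → ℕ → ℕ
    rank x j = first (λ m → signal x m j) j

    pointer-cong : ∀ {x y} m j → x ↾ j ≡ y ↾ j → pointer x m j ≡ pointer y m j
    signal-cong  : ∀ {x y} m j → x ↾ j ≡ y ↾ j → signal x m j ≡ signal y m j
    pointer-cong m zero    eq = refl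
    pointer-cong m (suc j) eq = cong₂ (λ b p → if b then suc p else p)
      (signal-cong m j (↾-mono (ℕ.n≤1+n j) eq)) (pointer-cong m j (↾-mono (ℕ.n≤1+n j) eq))
    signal-cong m j eq = cong₂ (λ p u → not (truth (Alive m p u))) (pointer-cong m j eq) eq

    rank-cong : ∀ {x y} j → x ↾ j ≡ y ↾ j → rank x j ≡ rank y j
    rank-cong j eq = first-cong j (λ m → signal-cong m j eq)

    module _ (x : Cantor) (m : ℕ) where

      private
        p : ℕ → ℕ
        p = pointer x m

      pointer-suc : ∀ j → p j ℕ.≤ p (suc j)
      pointer-suc j with signal x m j
      ... | true  = ℕ.n≤1+n (p j)
      ... | false = ℕ.≤-refl

      pointer-mono : ∀ {i j} → i ℕ.≤ j → p i ℕ.≤ p j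
      pointer-mono {i} {j} i≤j with ℕ.m≤n⇒m<n∨m≡n i≤j
      ... | inj₂ refl = ℕ.≤-refl
      pointer-mono {i} {suc j} _ | inj₁ (s≤s i≤j) = ℕ.≤-trans (pointer-mono i≤j) (pointer-suc j)

      Quiet : Set
      Quiet = ∃[ J ] ∀ j → J ℕ.≤ j → signal x m j ≡ false

      ¬Quiet⇒recurs : ¬ Quiet → ∀ J → ∃[ j ] J ℕ.≤ j × signal x m j ≡ true
      ¬Quiet⇒recurs ¬quiet J = decidable-stable em λ ¬∃ → ¬quiet
        (J , λ j J≤j → Bool.¬-not λ eq → ¬∃ (j , J≤j , eq))

      recurs⇒unbounded : (∀ J → ∃[ j ] J ℕ.≤ j × signal x m j ≡ true) → ∀ i → ∃[ j ] i ℕ.≤ p j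
      recurs⇒unbounded recurs zero    = 0 , z≤n
      recurs⇒unbounded recurs (suc i) =
        let (J , i≤) = recurs⇒unbounded recurs i
            (j , J≤j , sig) = recurs J
        in  suc j , subst (λ b → suc i ℕ.≤ (if b then suc (p j) else p j)) (sym sig)
                      (s≤s (ℕ.≤-trans i≤ (pointer-mono J≤j)))

      -- If `x` lies in `C m k`, then `x` itself keeps the guess `k` alive, so the pointer never
      -- moves past `k`.
      pointer-bound : ∀ {k} → C m k x → ∀ j → p j ℕ.≤ k
      pointer-bound {k} x∈C zero    = z≤n
      pointer-bound {k} x∈C (suc j) with em {Alive m (p j) (x ↾ j)}
      ... | yes _   = pointer-bound x∈C j
      ... | no dead = ℕ.≤∧≢⇒< (pointer-bound x∈C j)
        λ eq → dead (x , ≡⇒N↾ j refl , subst (λ k → C m k x) (sym eq) x∈C)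

      member⇒Quiet : ∀ {k} → C m k x → Quiet
      member⇒Quiet {k} x∈C = decidable-stable em λ ¬quiet →
        let (j , k<p) = recurs⇒unbounded (¬Quiet⇒recurs ¬quiet) (suc k)
        in  ℕ.<⇒≱ k<p (pointer-bound x∈C j)

      -- The pointer rests at a guess that no initial segment of `x` refutes; as `C m (p J)` is
      -- closed, it contains `x`.
      Quiet⇒member : Quiet → ∃[ k ] C m k x
      Quiet⇒member (J , quiet) = p J , decidable-stable em λ x∉C →
        let (n , out) = closed m (p J) x x∉C
            (y , h , y∈C) = truth⇒ (Bool.not-injective (quiet (J ℕ.+ n) (ℕ.m≤m+n J n)))
        in  out (≡⇒N↾ n (↾-mono (ℕ.m≤n+m n J) (N↾⇒≡ {y} {x} (J ℕ.+ n) h)))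
                (subst (λ k → C m k y) (constant n) y∈C)
        where
        constant : ∀ d → p (J ℕ.+ d) ≡ p J
        constant zero    = cong p (ℕ.+-identityʳ J)
        constant (suc d) = trans (cong p (ℕ.+-suc J d))
          (trans (cong (λ b → if b then suc (p (J ℕ.+ d)) else p (J ℕ.+ d))
                       (quiet (J ℕ.+ d) (ℕ.m≤m+n J d)))
                 (constant d))

    rank-→∞ : ∀ {x} → x ∈ ⋂ ℕ (λ m → ⋃ ℕ (C m)) → ∀ R → ∃[ J ] ∀ j → J ℕ.≤ j → R ℕ.≤ rank x j
    rank-→∞ {x} x∈ R = let (J , quiet) = quiet-below R in
      -- From `J` on all `m` below `R` are silent; `R` is added because `first` never exceeds `j`.
      J ℕ.⊔ R , λ j le → first-avoid (λ m → signal x m j) j (ℕ.≤-trans (ℕ.m≤n⊔m J R) le)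
                           (quiet j (ℕ.≤-trans (ℕ.m≤m⊔n J R) le))
      where
      quiet-below : ∀ R → ∃[ J ] ∀ j → J ℕ.≤ j → ∀ m → m ℕ.< R → signal x m j ≡ false
      quiet-below zero    = 0 , λ _ _ _ ()
      quiet-below (suc R) =
        let (J , quiet)   = quiet-below R
            (J′ , quiet′) = member⇒Quiet x R (proj₂ (x∈ R))
        in  J ℕ.⊔ J′ , λ j le m m<1+R → case ℕ.m≤n⇒m<n∨m≡n (ℕ.≤-pred m<1+R) of λ
              { (inj₁ m<R)  → quiet j (ℕ.≤-trans (ℕ.m≤m⊔n J J′) le) m m<R
              ; (inj₂ refl) → quiet′ j (ℕ.≤-trans (ℕ.m≤n⊔m J J′) le) }

    rank-recurs : ∀ {x} → ¬ x ∈ ⋂ ℕ (λ m → ⋃ ℕ (C m)) → ∃[ m ] ∀ J → ∃[ j ] J ℕ.≤ j × rank x j ℕ.≤ m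
    rank-recurs {x} x∉ =
      let (m , ∉m) = ¬∀⇒∃¬ x∉
      in  m , λ J → let (j , J≤j , sig) = ¬Quiet⇒recurs x m (∉m ∘ Quiet⇒member x m) J
                    in  j , J≤j , first-hit (λ m → signal x m j) j sig

  -- The reduction and comeagerness.

  Generic⇒CompleteΠ⁰₃ : ⋂ ℕ Generic ⊆ (λ A → CompleteΠ⁰₃ (Φ (set A)))
  Generic⇒CompleteΠ⁰₃ {A} gen = Φ-Fσδ (set A) , hard
    where
    hard : ∀ Q → Fσδ Q → ∃[ f ] Continuous f × Q ≐ (f ⊢ Φ (set A))
    hard Q (C , closed , Q⊆ , ⊆Q) = f , continuous
      , (λ x∈Q → rank→∞⇒∈Φ A gen (rank C closed _) (rank≤ _) (rank-→∞ C closed (Q⊆ x∈Q)))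
      , (λ {x} fx∈Φ → ⊆Q (decidable-stable em λ x∉ →
          let (m , recurs) = rank-recurs C closed x∉
          in  rank-recurs⇒∉Φ A gen (rank C closed x) (rank≤ x) m recurs fx∈Φ))
      where
      f : Cantor → Cantor
      f x = run (rule A gen (rank C closed x))
      rank≤ : ∀ x j → rank C closed x j ℕ.≤ j
      rank≤ x j = first-≤ (λ m → signal C closed x m j) j
      -- The first `n` bits of `f x` use only ranks with index below `n`, and these are read off
      -- `x ↾ n`.
      continuous : Continuous f
      continuous U open-U x fx∈U =
        let (n , ⊆U) = open-U (f x) fx∈U
        in  n , λ {y} h → ⊆U (≡⇒N↾ n (run-cong n (rule-cong A gen n
                  (λ j j<n → rank-cong C closed j (↾-mono (ℕ.<⇒≤ j<n) (N↾⇒≡ {y} {x} n h))))))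

theorem1p7 : (em : ∀ ℓ → ExcludedMiddle ℓ) →
    Comeager (MALG (em 0ℓ)) (λ A → CompleteΠ⁰₃ (Φ (set A)))
theorem1p7 em = Generic (em 0ℓ) , Generic-open (em 0ℓ) , Generic-dense (em 0ℓ) ,
  λ {A} → Generic⇒CompleteΠ⁰₃ (em 0ℓ) {A}
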